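{- Let $p>3$ be a prime, let $a\in\mathbb{Z}_p$ with $a\not\equiv0\pmod p$, let $\langle a\rangle_p$ be the least nonnegative residue of $a$ modulo $p$, and let $t=(a-\langle a\rangle_p)/p$. Then $$\sum_{k=0}^{(p-1)/2}\binom ak\binom{ -1-a}k\frac{2a+1}{2k+1}\equiv\begin{cases}1+2t+4ptq_p(2)-2pt\big(B_{p-1}(-a)-B_{p-1}\big)\pmod{p^2}&\text{if }\langle a\rangle_p\le\frac{p-1}2,\\ 1+2t+4p(t+1)q_p(2)-2p(t+1)\big(B_{p-1}(-a)-B_{p-1}\big)\pmod{p^2}&\text{if }\langle a\rangle_p>\frac{p-1}2.\end{cases}$$
   Context: $\mathbb{Z}_p$ denotes the set of rational numbers whose denominator is not divisible by $p$; congruences modulo $p^m$ are taken in $\mathbb{Z}_p$. For $a\in\mathbb{Z}_p$, $\langle a\rangle_p\in\{0,1,\dots,p-1\}$ satisfies $\langle a\rangle_p\equiv a\pmod p$. $\binom xk=x(x-1)\cdots(x-k+1)/k!$. $q_p(2)=(2^{p-1}-1)/p$. The Bernoulli numbers are defined by $B_0=1$ and $\sum_{k=0}^{n-1}\binom nkB_k=0$ ($n\ge2$), and the Bernoulli polynomials by $B_n(x)=\sum_{k=0}^n\binom nkB_kx^{n-k}$. -}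

module Defs where

open import Data.Nat as ℕ using (ℕ; zero; suc; _!)
open import Data.Nat.Divisibility using (_∣_)
open import Data.Nat.Combinatorics using (_C_)
open import Data.Integer as ℤ using (ℤ; +_)
open import Data.Rational using (ℚ; _+_; _*_; _-_; -_; 0ℚ; 1ℚ; ↧ₙ_)
import Data.Rational as Q
open import Data.List using (List; []; _∷_; _++_; foldr; map; zipWith; upTo)
open import Data.Product using (Σ; _×_)
open import Relation.Nullary using (¬_)
open import Relation.Binary.PropositionalEquality using (_≡_)

ℕ→ℚ : ℕ → ℚ
ℕ→ℚ n = + n Q./ 1

-- 1/n for n ≥ 1 (and 0 for n = 0, never used there)
invℕ : ℕ → ℚ
invℕ zero = 0ℚ
invℕ (suc n) = + 1 Q./ suc n

_^ℚ_ : ℚ → ℕ → ℚ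
x ^ℚ zero = 1ℚ
x ^ℚ suc n = x * (x ^ℚ n)

sumℚ : List ℚ → ℚ
sumℚ = foldr _+_ 0ℚ

prodℚ : List ℚ → ℚ
prodℚ = foldr _*_ 1ℚ

sumTo : ℕ → (ℕ → ℚ) → ℚ
sumTo n f = sumℚ (map f (upTo n))

binomℚ : ℚ → ℕ → ℚ
binomℚ x k = prodℚ (map (λ i → x - ℕ→ℚ i) (upTo k)) * invℕ (k !)

InZp : ℕ → ℚ → Set
InZp p x = ¬ (p ∣ ↧ₙ x)

_≡_[mod_^_] : ℚ → ℚ → ℕ → ℕ → Set
x ≡ y [mod p ^ m ] = Σ ℚ (λ z → InZp p z × (x - y ≡ (ℕ→ℚ p ^ℚ m) * z))

-- Bernoulli numbers: B_0 = 1, and for m ≥ 1 the relation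
-- Σ_{k=0}^{m} C(m+1,k) B_k = 0 solved for B_m.
-- nextB m l, where l = [B_0, ..., B_{m-1}], computes B_m.
nextB : ℕ → List ℚ → ℚ
nextB zero l = 1ℚ
nextB (suc m) l =
  - (invℕ (suc (suc m)) * sumℚ (zipWith (λ k b → ℕ→ℚ (suc (suc m) C k) * b) (upTo (suc m)) l))

firstB : ℕ → List ℚ
firstB zero = []
firstB (suc n) = firstB n ++ (nextB n (firstB n) ∷ [])

bernoulli : ℕ → ℚ
bernoulli n = nextB n (firstB n)

bernoulliPoly : ℕ → ℚ → ℚ
bernoulliPoly n x = sumTo (suc n) (λ k → ℕ→ℚ (n C k) * bernoulli k * (x ^ℚ (n ℕ.∸ k)))

fermatQuot2 : ℕ → ℚ
fermatQuot2 p = (ℕ→ℚ (2 ℕ.^ (p ℕ.∸ 1)) - 1ℚ) * invℕ p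

{-# OPTIONS --safe #-}

-- Write p = 2n + 1 and a = r + pt, let F(x) = ∑_{k≤n} C(x,k) C(−1−x,k) (2x+1)/(2k+1) and
-- T(x) = ∏_{i=1}^{n} (1 − x²/i²).  Telescoping gives F(x+1) − F(x) = 2 T(x+1), while
-- (x+1) T(x+1) − x T(x) = p C(x,n) C(−1−x,n) is divisible by p² at x = pt + j with 0 ≤ j < n;
-- as T(pt) ≡ 1, this yields T(pt+j) ≡ pt/j (mod p²) for 1 ≤ j ≤ n.  A direct expansion gives
-- F(pt) ≡ 1 + 2t − 2pt Hₙ, so F(pt+r) ≡ 1 + 2t − 2pt Hₙ + 2pt Hᵣ for r ≤ n.  Modulo p one has
-- Hₙ ≡ −2 q_p(2), from the binomial expansion of 2ᵖ, and Hᵣ ≡ −(B_{p−1}(−a) − B_{p−1}), from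
-- B_{p−1}(x+1) − B_{p−1}(x) = (p−1) x^{p−2} and Fermat's little theorem.  The case r > n
-- follows from F(−1−x) = −F(x).

module Submission where

open import Defs
open import Data.Integer as ℤ using (ℤ)
import Data.Integer.Properties as ℤP
open import Data.List using ([]; _∷_; _++_; map; zipWith; upTo)
import Data.List.Properties as LP
open import Data.Nat as ℕ using (ℕ; zero; suc; _<_; _≤_; _>_; _/_; _∸_; _!; s≤s; z≤n)
open import Data.Nat.Combinatorics using (_C_; nCn≡1; nC1≡n; nCk≡nC[n∸k]; k>n⇒nCk≡0; nCk≡n!/k![n-k]!; k![n∸k]!∣n!; nCk+nC[k+1]≡[n+1]C[k+1])
open import Data.Nat.Coprimality as Coprime using (coprime-divisor)
open import Data.Nat.Divisibility as ∣ using (_∣_; divides)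
import Data.Nat.DivMod as ℕD
open import Data.Nat.Primality using (Prime; euclidsLemma; ¬prime[1]; prime⇒irreducible)
import Data.Nat.Properties as ℕP
open import Data.Nat.Solver using (module +-*-Solver)
open import Data.Product using (_×_; _,_; ∃; proj₁; proj₂)
open import Data.Rational using (ℚ; _+_; _*_; _-_; -_; 0ℚ; 1ℚ; ↧ₙ_; ↥_; toℚᵘ; fromℚᵘ; mkℚ)
import Data.Rational as Q
import Data.Rational.Properties as ℚP
import Data.Rational.Unnormalised as ℚᵘ
import Data.Rational.Unnormalised.Properties as ℚᵘP
open import Data.Sum using (inj₁; inj₂)
open import Function using (_∘_)
open import Level using (0ℓ)
open import Relation.Binary.Bundles using (Setoid)
open import Relation.Binary.PropositionalEquality
import Relation.Binary.Reasoning.Setoid as SetoidReasoning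
open import Relation.Nullary using (¬_; contradiction; yes; no)
open import Relation.Nullary.Decidable using (dec⇒maybe)
open import Tactic.RingSolver using (solve-∀)
open import Tactic.RingSolver.Core.AlmostCommutativeRing using (AlmostCommutativeRing; fromCommutativeRing)
open ℕP using (_!≢0)

-- The obstacle is the summand with k = n: its weight is 1/(2n+1) = 1/p, so reducing the sum
-- termwise modulo p² would need that summand's binomial product modulo p³. Two devices avoid this.
-- Moving from pt to pt + r uses the exact difference identity, in which only `∏` occurs and no
-- weight. At x = pt the binomial product carries an explicit factor pt; its p absorbs the 1/p, and
-- what remains is needed modulo p² only. The 1/p does not disappear: it returns as the last term of
-- H_p and produces the main term 2t. The second factor p in p C(x,n) C(-1-x,n) comes from (x - n)
-- C(x,n) C(-1-x,n) = x T(x), because x - n is a unit at x = pt + j with j < n. Harmonic numbers,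
-- the Fermat quotient and the Bernoulli difference enter the result only with a factor p in front,
-- so each is needed modulo p alone. B_{p-1} itself is not p-integral, hence it is never separated
-- from B_{p-1}(-a).

ℚ-ring : AlmostCommutativeRing _ _
ℚ-ring = fromCommutativeRing ℚP.+-*-commutativeRing (λ x → dec⇒maybe (0ℚ ℚP.≟ x))

2ℚ 4ℚ : ℚ
2ℚ = ℕ→ℚ 2
4ℚ = ℕ→ℚ 4

-- Embeddings of ℤ and ℕ in ℚ, and reciprocals

fromℚᵘ-homo-+ : ∀ x y → fromℚᵘ (x ℚᵘ.+ y) ≡ fromℚᵘ x + fromℚᵘ y
fromℚᵘ-homo-+ x y = ℚP.toℚᵘ-injective (ℚᵘP.≃-trans (ℚP.toℚᵘ-fromℚᵘ (x ℚᵘ.+ y))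
  (ℚᵘP.≃-sym (ℚᵘP.≃-trans (ℚP.toℚᵘ-homo-+ (fromℚᵘ x) (fromℚᵘ y))
    (ℚᵘP.+-cong (ℚP.toℚᵘ-fromℚᵘ x) (ℚP.toℚᵘ-fromℚᵘ y)))))

fromℚᵘ-homo-* : ∀ x y → fromℚᵘ (x ℚᵘ.* y) ≡ fromℚᵘ x * fromℚᵘ y
fromℚᵘ-homo-* x y = ℚP.toℚᵘ-injective (ℚᵘP.≃-trans (ℚP.toℚᵘ-fromℚᵘ (x ℚᵘ.* y))
  (ℚᵘP.≃-sym (ℚᵘP.≃-trans (ℚP.toℚᵘ-homo-* (fromℚᵘ x) (fromℚᵘ y))
    (ℚᵘP.*-cong (ℚP.toℚᵘ-fromℚᵘ x) (ℚP.toℚᵘ-fromℚᵘ y)))))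

ℤ→ℚ : ℤ → ℚ
ℤ→ℚ i = i Q./ 1

-- `i / 1` unfolds to `fromℚᵘ` of the unnormalised fraction i over 1, so the claim becomes a
-- cross-multiplication in ℤ and no gcd has to be computed.
ℤ→ℚ-+ : ∀ i j → ℤ→ℚ (i ℤ.+ j) ≡ ℤ→ℚ i + ℤ→ℚ j
ℤ→ℚ-+ i j = trans
  (ℚP.fromℚᵘ-cong {ℚᵘ.mkℚᵘ (i ℤ.+ j) 0} {ℚᵘ.mkℚᵘ i 0 ℚᵘ.+ ℚᵘ.mkℚᵘ j 0}
    (ℚᵘ.*≡* (cong (ℤ._* ℤ.+ 1) (sym (cong₂ ℤ._+_ (ℤP.*-identityʳ i) (ℤP.*-identityʳ j))))))
  (fromℚᵘ-homo-+ (ℚᵘ.mkℚᵘ i 0) (ℚᵘ.mkℚᵘ j 0))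

ℤ→ℚ-* : ∀ i j → ℤ→ℚ (i ℤ.* j) ≡ ℤ→ℚ i * ℤ→ℚ j
ℤ→ℚ-* i j = fromℚᵘ-homo-* (ℚᵘ.mkℚᵘ i 0) (ℚᵘ.mkℚᵘ j 0)

ℕ→ℚ-+ : ∀ m n → ℕ→ℚ (m ℕ.+ n) ≡ ℕ→ℚ m + ℕ→ℚ n
ℕ→ℚ-+ m n = ℤ→ℚ-+ (ℤ.+ m) (ℤ.+ n)

ℕ→ℚ-* : ∀ m n → ℕ→ℚ (m ℕ.* n) ≡ ℕ→ℚ m * ℕ→ℚ n
ℕ→ℚ-* m n = trans (cong ℤ→ℚ (ℤP.pos-* m n)) (ℤ→ℚ-* (ℤ.+ m) (ℤ.+ n))

ℕ→ℚ-suc : ∀ n → ℕ→ℚ (suc n) ≡ ℕ→ℚ n + 1ℚ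
ℕ→ℚ-suc n = trans (ℕ→ℚ-+ 1 n) (ℚP.+-comm 1ℚ (ℕ→ℚ n))

-ℕ→ℚ-suc : ∀ n → - ℕ→ℚ (suc n) + 1ℚ ≡ - ℕ→ℚ n
-ℕ→ℚ-suc n = trans (cong (λ y → - y + 1ℚ) (ℕ→ℚ-suc n)) (lemma (ℕ→ℚ n))
  where
  lemma : ∀ y → - (y + 1ℚ) + 1ℚ ≡ - y
  lemma = solve-∀ ℚ-ring

invℕ-inverseʳ : ∀ n → ℕ→ℚ (suc n) * invℕ (suc n) ≡ 1ℚ
invℕ-inverseʳ n = trans (sym (fromℚᵘ-homo-* (ℚᵘ.mkℚᵘ (ℤ.+ suc n) 0) (ℚᵘ.mkℚᵘ (ℤ.+ 1) n)))
  (ℚP.fromℚᵘ-cong {ℚᵘ.mkℚᵘ (ℤ.+ suc n) 0 ℚᵘ.* ℚᵘ.mkℚᵘ (ℤ.+ 1) n} {ℚᵘ.mkℚᵘ (ℤ.+ 1) 0}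
    (ℚᵘ.*≡* (trans (cong (ℤ._* ℤ.+ 1) (ℤP.*-identityʳ (ℤ.+ suc n)))
      (trans (ℤP.*-identityʳ (ℤ.+ suc n)) (trans (cong (λ m → ℤ.+ suc m) (sym (ℕP.+-identityʳ n)))
        (sym (ℤP.*-identityˡ _)))))))

inverse-unique : ∀ x {y z} → x * y ≡ 1ℚ → x * z ≡ 1ℚ → y ≡ z
inverse-unique x {y} {z} xy xz = begin
  y           ≡⟨ ℚP.*-identityʳ y ⟨
  y * 1ℚ      ≡⟨ cong (y *_) xz ⟨
  y * (x * z) ≡⟨ lemma x y z ⟩
  x * y * z   ≡⟨ cong (_* z) xy ⟩
  1ℚ * z      ≡⟨ ℚP.*-identityˡ z ⟩
  z           ∎
  where
  open ≡-Reasoning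
  lemma : ∀ x y z → y * (x * z) ≡ x * y * z
  lemma = solve-∀ ℚ-ring

invℕ-* : ∀ m n → invℕ (suc m ℕ.* suc n) ≡ invℕ (suc m) * invℕ (suc n)
invℕ-* m n = inverse-unique (ℕ→ℚ (suc m ℕ.* suc n)) (invℕ-inverseʳ (n ℕ.+ m ℕ.* suc n)) (begin
  ℕ→ℚ (suc m ℕ.* suc n) * (invℕ (suc m) * invℕ (suc n))
    ≡⟨ cong (_* (invℕ (suc m) * invℕ (suc n))) (ℕ→ℚ-* (suc m) (suc n)) ⟩
  ℕ→ℚ (suc m) * ℕ→ℚ (suc n) * (invℕ (suc m) * invℕ (suc n))
    ≡⟨ lemma (ℕ→ℚ (suc m)) (ℕ→ℚ (suc n)) (invℕ (suc m)) (invℕ (suc n)) ⟩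
  ℕ→ℚ (suc m) * invℕ (suc m) * (ℕ→ℚ (suc n) * invℕ (suc n))
    ≡⟨ cong₂ _*_ (invℕ-inverseʳ m) (invℕ-inverseʳ n) ⟩
  1ℚ ∎)
  where
  open ≡-Reasoning
  lemma : ∀ x y u v → x * y * (u * v) ≡ x * u * (y * v)
  lemma = solve-∀ ℚ-ring

-- Finite sums

-- `sumTo` folds a list from its head. This recursion exposes the last summand instead, as
-- inductions on the upper bound require; `sumTo≡∑` links the two.
∑ : ℕ → (ℕ → ℚ) → ℚ
∑ zero    f = 0ℚ
∑ (suc n) f = ∑ n f + f n

∑-cong : ∀ n {f g : ℕ → ℚ} → (∀ k → k < n → f k ≡ g k) → ∑ n f ≡ ∑ n g
∑-cong zero    eq = refl
∑-cong (suc n) eq = cong₂ _+_ (∑-cong n λ k k<n → eq k (ℕP.m<n⇒m<1+n k<n)) (eq n (ℕP.n<1+n n))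

∑-0 : ∀ n → ∑ n (λ _ → 0ℚ) ≡ 0ℚ
∑-0 zero    = refl
∑-0 (suc n) = cong (_+ 0ℚ) (∑-0 n)

∑-+ : ∀ n f g → ∑ n (λ k → f k + g k) ≡ ∑ n f + ∑ n g
∑-+ zero    f g = refl
∑-+ (suc n) f g = trans (cong (_+ (f n + g n)) (∑-+ n f g)) (lemma (∑ n f) (∑ n g) (f n) (g n))
  where
  lemma : ∀ x y u v → x + y + (u + v) ≡ x + u + (y + v)
  lemma = solve-∀ ℚ-ring

∑-*ˡ : ∀ n c f → ∑ n (λ k → c * f k) ≡ c * ∑ n f
∑-*ˡ zero    c f = sym (ℚP.*-zeroʳ c)
∑-*ˡ (suc n) c f = trans (cong (_+ c * f n) (∑-*ˡ n c f)) (sym (ℚP.*-distribˡ-+ c (∑ n f) (f n)))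

∑-neg : ∀ n f → ∑ n (λ k → - f k) ≡ - ∑ n f
∑-neg zero    f = refl
∑-neg (suc n) f = trans (cong (_+ - f n) (∑-neg n f)) (sym (ℚP.neg-distrib-+ (∑ n f) (f n)))

∑-head : ∀ n f → ∑ (suc n) f ≡ f 0 + ∑ n (f ∘ suc)
∑-head zero    f = ℚP.+-comm 0ℚ (f 0)
∑-head (suc n) f = trans (cong (_+ f (suc n)) (∑-head n f)) (ℚP.+-assoc (f 0) _ _)

∑-swap : ∀ m n (f : ℕ → ℕ → ℚ) → ∑ m (λ i → ∑ n (f i)) ≡ ∑ n (λ j → ∑ m (λ i → f i j))
∑-swap zero    n f = sym (∑-0 n)
∑-swap (suc m) n f = trans (cong (_+ ∑ n (f m)) (∑-swap m n f)) (sym (∑-+ n (λ j → ∑ m (λ i → f i j)) (f m)))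

∑-reverse : ∀ n f → ∑ n f ≡ ∑ n (λ k → f (n ∸ suc k))
∑-reverse zero    f = refl
∑-reverse (suc n) f = begin
  ∑ n f + f n                           ≡⟨ cong (_+ f n) (∑-reverse n f) ⟩
  ∑ n (λ k → f (n ∸ suc k)) + f n       ≡⟨ ℚP.+-comm _ (f n) ⟩
  f n + ∑ n (λ k → f (n ∸ suc k))       ≡⟨ ∑-head n (λ k → f (n ∸ k)) ⟨
  ∑ (suc n) (λ k → f (n ∸ k))           ∎
  where open ≡-Reasoning

∑-extend : ∀ n d f → (∀ k → n ≤ k → f k ≡ 0ℚ) → ∑ (d ℕ.+ n) f ≡ ∑ n f
∑-extend n zero    f z = refl
∑-extend n (suc d) f z = trans (cong₂ _+_ (∑-extend n d f z) (z (d ℕ.+ n) (ℕP.m≤n+m n d))) (ℚP.+-identityʳ _)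

sumℚ-++ : ∀ xs y → sumℚ (xs ++ y ∷ []) ≡ sumℚ xs + y
sumℚ-++ []       y = ℚP.+-comm y 0ℚ
sumℚ-++ (x ∷ xs) y = trans (cong (x +_) (sumℚ-++ xs y)) (sym (ℚP.+-assoc x (sumℚ xs) y))

prodℚ-++ : ∀ xs y → prodℚ (xs ++ y ∷ []) ≡ prodℚ xs * y
prodℚ-++ []       y = ℚP.*-comm y 1ℚ
prodℚ-++ (x ∷ xs) y = trans (cong (x *_) (prodℚ-++ xs y)) (sym (ℚP.*-assoc x (prodℚ xs) y))

map-upTo-suc : ∀ {A : Set} (f : ℕ → A) n → map f (upTo (suc n)) ≡ map f (upTo n) ++ f n ∷ []
map-upTo-suc f n = trans (cong (map f) (sym (LP.upTo-∷ʳ n))) (LP.map-++ f (upTo n) (n ∷ []))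

sumTo≡∑ : ∀ n f → sumTo n f ≡ ∑ n f
sumTo≡∑ zero    f = refl
sumTo≡∑ (suc n) f = begin
  sumℚ (map f (upTo (suc n)))       ≡⟨ cong sumℚ (map-upTo-suc f n) ⟩
  sumℚ (map f (upTo n) ++ f n ∷ []) ≡⟨ sumℚ-++ (map f (upTo n)) (f n) ⟩
  sumTo n f + f n                   ≡⟨ cong (_+ f n) (sumTo≡∑ n f) ⟩
  ∑ n f + f n                       ∎
  where open ≡-Reasoning

binomℚ-suc : ∀ x k → binomℚ x (suc k) ≡ binomℚ x k * ((x - ℕ→ℚ k) * invℕ (suc k))
binomℚ-suc x k = begin
  binomℚ x (suc k)
    ≡⟨ cong₂ _*_ (trans (cong prodℚ (map-upTo-suc f k)) (prodℚ-++ (map f (upTo k)) (f k))) inv-! ⟩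
  prodℚ (map f (upTo k)) * f k * (invℕ (suc k) * invℕ (k !))
    ≡⟨ lemma (prodℚ (map f (upTo k))) (f k) (invℕ (suc k)) (invℕ (k !)) ⟩
  binomℚ x k * (f k * invℕ (suc k)) ∎
  where
  open ≡-Reasoning
  f : ℕ → ℚ
  f i = x - ℕ→ℚ i
  lemma : ∀ a b c d → a * b * (c * d) ≡ a * d * (b * c)
  lemma = solve-∀ ℚ-ring
  inv-! : invℕ (suc k !) ≡ invℕ (suc k) * invℕ (k !)
  -- `invℕ-*` speaks of successors only, so k ! has to be exhibited as one.
  inv-! with k ! | k !≢0
  ... | suc m | _ = invℕ-* k m

-- Binomial coefficients

nCk*k![n∸k]!≡n! : ∀ {n k} → k ≤ n → (n C k) ℕ.* (k ! ℕ.* (n ∸ k) !) ≡ n !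
nCk*k![n∸k]!≡n! {n} {k} k≤n = trans (cong (ℕ._* (k ! ℕ.* (n ∸ k) !)) (nCk≡n!/k![n-k]! k≤n)) (ℕD.m/n*n≡m (k![n∸k]!∣n! k≤n))
  where instance _ = k ℕP.!* (n ∸ k) !≢0

[k+1]*[n+1]C[k+1]≡[n+1]*nCk : ∀ {n k} → k ≤ n → suc k ℕ.* (suc n C suc k) ≡ suc n ℕ.* (n C k)
[k+1]*[n+1]C[k+1]≡[n+1]*nCk {n} {k} k≤n = ℕP.*-cancelʳ-≡ _ _ (k ! ℕ.* (n ∸ k) !) (begin
  suc k ℕ.* (suc n C suc k) ℕ.* (k ! ℕ.* (n ∸ k) !) ≡⟨ cong (ℕ._* (k ! ℕ.* (n ∸ k) !)) (ℕP.*-comm (suc k) (suc n C suc k)) ⟩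
  (suc n C suc k) ℕ.* suc k ℕ.* (k ! ℕ.* (n ∸ k) !) ≡⟨ ℕP.*-assoc (suc n C suc k) (suc k) _ ⟩
  (suc n C suc k) ℕ.* (suc k ℕ.* (k ! ℕ.* (n ∸ k) !)) ≡⟨ cong ((suc n C suc k) ℕ.*_) (ℕP.*-assoc (suc k) (k !) _) ⟨
  (suc n C suc k) ℕ.* (suc k ! ℕ.* (n ∸ k) !) ≡⟨ nCk*k![n∸k]!≡n! (s≤s k≤n) ⟩
  suc n ℕ.* n !                               ≡⟨ cong (suc n ℕ.*_) (nCk*k![n∸k]!≡n! k≤n) ⟨
  suc n ℕ.* ((n C k) ℕ.* (k ! ℕ.* (n ∸ k) !)) ≡⟨ ℕP.*-assoc (suc n) (n C k) _ ⟨
  suc n ℕ.* (n C k) ℕ.* (k ! ℕ.* (n ∸ k) !)   ∎)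
  where
  open ≡-Reasoning
  instance _ = k ℕP.!* (n ∸ k) !≢0

nCk*[n∸k]Cj*k!j!≡n! : ∀ {n k j} → k ≤ n → j ≤ n ∸ k →
  (n C k) ℕ.* ((n ∸ k) C j) ℕ.* (k ! ℕ.* j ! ℕ.* (n ∸ (k ℕ.+ j)) !) ≡ n !
nCk*[n∸k]Cj*k!j!≡n! {n} {k} {j} k≤n j≤n∸k = begin
  a ℕ.* b ℕ.* (k ! ℕ.* j ! ℕ.* (n ∸ (k ℕ.+ j)) !) ≡⟨ cong (λ i → a ℕ.* b ℕ.* (k ! ℕ.* j ! ℕ.* i !)) (ℕP.∸-+-assoc n k j) ⟨
  a ℕ.* b ℕ.* (k ! ℕ.* j ! ℕ.* (n ∸ k ∸ j) !) ≡⟨ lemma a b (k !) (j !) ((n ∸ k ∸ j) !) ⟩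
  a ℕ.* (k ! ℕ.* (b ℕ.* (j ! ℕ.* (n ∸ k ∸ j) !))) ≡⟨ cong (λ i → a ℕ.* (k ! ℕ.* i)) (nCk*k![n∸k]!≡n! j≤n∸k) ⟩
  a ℕ.* (k ! ℕ.* (n ∸ k) !) ≡⟨ nCk*k![n∸k]!≡n! k≤n ⟩
  n ! ∎
  where
  open ≡-Reasoning
  open +-*-Solver
  a b : ℕ
  a = n C k
  b = (n ∸ k) C j
  lemma : ∀ a b c d e → a ℕ.* b ℕ.* (c ℕ.* d ℕ.* e) ≡ a ℕ.* (c ℕ.* (b ℕ.* (d ℕ.* e)))
  lemma = solve 5 (λ a b c d e → a :* b :* (c :* d :* e) := a :* (c :* (b :* (d :* e)))) refl

-- If k + j ≤ n, both products are the multinomial coefficient n!/(k! j! (n-k-j)!), which is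
-- symmetric in k and j; otherwise both vanish.
nCk*[n∸k]Cj≡nCj*[n∸j]Ck : ∀ {n k j} → k ≤ n → j ≤ n → (n C k) ℕ.* ((n ∸ k) C j) ≡ (n C j) ℕ.* ((n ∸ j) C k)
nCk*[n∸k]Cj≡nCj*[n∸j]Ck {n} {k} {j} k≤n j≤n with j ℕP.≤? n ∸ k
... | yes j≤n∸k = ℕP.*-cancelʳ-≡ _ _ (k ! ℕ.* j ! ℕ.* (n ∸ (k ℕ.+ j)) !) (trans (nCk*[n∸k]Cj*k!j!≡n! k≤n j≤n∸k)
    (sym (trans (cong ((n C j) ℕ.* ((n ∸ j) C k) ℕ.*_)
      (cong₂ ℕ._*_ (ℕP.*-comm (k !) (j !)) (cong (λ i → (n ∸ i) !) (ℕP.+-comm k j))))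
    (nCk*[n∸k]Cj*k!j!≡n! j≤n (ℕP.m+n≤o⇒m≤o∸n k (subst (_≤ n) (ℕP.+-comm j k) (ℕP.m≤o∸n⇒m+n≤o j k≤n j≤n∸k)))))))
  where instance _ = ℕP.m*n≢0 (k ! ℕ.* j !) ((n ∸ (k ℕ.+ j)) !) {{k ℕP.!* j !≢0}} {{(n ∸ (k ℕ.+ j)) !≢0}}
... | no j≰n∸k = trans (vanish n k (ℕP.≰⇒> j≰n∸k)) (sym (vanish n j (ℕP.≰⇒> λ k≤n∸j →
    j≰n∸k (ℕP.m+n≤o⇒m≤o∸n j (subst (_≤ n) (ℕP.+-comm k j) (ℕP.m≤o∸n⇒m+n≤o k j≤n k≤n∸j))))))
  where
  vanish : ∀ n k {j} → j > n ∸ k → (n C k) ℕ.* ((n ∸ k) C j) ≡ 0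
  vanish n k j> = trans (cong ((n C k) ℕ.*_) (k>n⇒nCk≡0 j>)) (ℕP.*-zeroʳ (n C k))

ℕ→ℚ-nCk≡0 : ∀ {n k} x → n < k → ℕ→ℚ (n C k) * x ≡ 0ℚ
ℕ→ℚ-nCk≡0 x n<k = trans (cong (λ c → ℕ→ℚ c * x) (k>n⇒nCk≡0 n<k)) (ℚP.*-zeroˡ x)

binomial-theorem : ∀ n x → (x + 1ℚ) ^ℚ n ≡ ∑ (suc n) (λ k → ℕ→ℚ (n C k) * x ^ℚ k)
binomial-theorem zero    x = refl
binomial-theorem (suc n) x = sym (begin
  ∑ (suc (suc n)) (λ k → ℕ→ℚ (suc n C k) * x ^ℚ k)
    ≡⟨ ∑-head (suc n) (λ k → ℕ→ℚ (suc n C k) * x ^ℚ k) ⟩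
  1ℚ + ∑ (suc n) (λ k → ℕ→ℚ (suc n C suc k) * x ^ℚ suc k)
    ≡⟨ cong (1ℚ +_) (trans (∑-cong (suc n) (λ k _ → pascal k))
         (trans (∑-+ (suc n) (λ k → x * f k) (f ∘ suc)) (cong (_+ ∑ (suc n) (f ∘ suc)) (∑-*ˡ (suc n) x f)))) ⟩
  1ℚ + (x * ∑ (suc n) f + ∑ (suc n) (f ∘ suc))
    ≡⟨ rearrange x (∑ (suc n) f) (∑ (suc n) (f ∘ suc)) ⟩
  x * ∑ (suc n) f + (1ℚ + ∑ (suc n) (f ∘ suc))
    ≡⟨ cong (x * ∑ (suc n) f +_) (∑-head (suc n) f) ⟨
  x * ∑ (suc n) f + (∑ (suc n) f + f (suc n))
    ≡⟨ cong (λ y → x * ∑ (suc n) f + (∑ (suc n) f + y)) (ℕ→ℚ-nCk≡0 (x ^ℚ suc n) (ℕP.n<1+n n)) ⟩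
  x * ∑ (suc n) f + (∑ (suc n) f + 0ℚ)
    ≡⟨ collect x (∑ (suc n) f) ⟩
  (x + 1ℚ) * ∑ (suc n) f
    ≡⟨ cong ((x + 1ℚ) *_) (binomial-theorem n x) ⟨
  (x + 1ℚ) ^ℚ suc n ∎)
  where
  open ≡-Reasoning
  f : ℕ → ℚ
  f k = ℕ→ℚ (n C k) * x ^ℚ k
  rearrange : ∀ x a b → 1ℚ + (x * a + b) ≡ x * a + (1ℚ + b)
  rearrange = solve-∀ ℚ-ring
  collect : ∀ x a → x * a + (a + 0ℚ) ≡ (x + 1ℚ) * a
  collect = solve-∀ ℚ-ring
  expand : ∀ a b x y → (a + b) * (x * y) ≡ x * (a * y) + b * (x * y)
  expand = solve-∀ ℚ-ring
  pascal : ∀ k → ℕ→ℚ (suc n C suc k) * x ^ℚ suc k ≡ x * f k + f (suc k)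
  pascal k = begin
    ℕ→ℚ (suc n C suc k) * x ^ℚ suc k ≡⟨ cong (λ c → ℕ→ℚ c * x ^ℚ suc k) (nCk+nC[k+1]≡[n+1]C[k+1] n k) ⟨
    ℕ→ℚ (n C k ℕ.+ n C suc k) * x ^ℚ suc k ≡⟨ cong (_* x ^ℚ suc k) (ℕ→ℚ-+ (n C k) (n C suc k)) ⟩
    (ℕ→ℚ (n C k) + ℕ→ℚ (n C suc k)) * x ^ℚ suc k ≡⟨ expand (ℕ→ℚ (n C k)) (ℕ→ℚ (n C suc k)) x (x ^ℚ k) ⟩
    x * f k + f (suc k) ∎

-- A common upper bound N for all exponents n makes the double sum in `bernoulliPoly-difference`
-- rectangular, so that it can be swapped.
binomial-theorem-≤ : ∀ {n N} x → n ≤ N → (x + 1ℚ) ^ℚ n ≡ ∑ (suc N) (λ k → ℕ→ℚ (n C k) * x ^ℚ k)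
binomial-theorem-≤ {n} {N} x n≤N = trans (binomial-theorem n x) (sym (trans
  (cong (λ m → ∑ m (λ k → ℕ→ℚ (n C k) * x ^ℚ k)) (trans (cong suc (sym (ℕP.m∸n+n≡m n≤N))) (sym (ℕP.+-suc (N ∸ n) n))))
  (∑-extend (suc n) (N ∸ n) _ λ k n<k → ℕ→ℚ-nCk≡0 (x ^ℚ k) n<k)))

-- Bernoulli numbers and polynomials

firstB≡map : ∀ n → firstB n ≡ map bernoulli (upTo n)
firstB≡map zero    = refl
firstB≡map (suc n) = trans (cong (_++ bernoulli n ∷ []) (firstB≡map n)) (sym (map-upTo-suc bernoulli n))

zipWith-mapʳ : ∀ {A B C : Set} (f : A → B → C) (g : A → B) xs → zipWith f xs (map g xs) ≡ map (λ x → f x (g x)) xs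
zipWith-mapʳ f g []       = refl
zipWith-mapʳ f g (x ∷ xs) = cong (f x (g x) ∷_) (zipWith-mapʳ f g xs)

bernoulli-suc : ∀ m → bernoulli (suc m) ≡
  - (invℕ (suc (suc m)) * ∑ (suc m) (λ k → ℕ→ℚ (suc (suc m) C k) * bernoulli k))
bernoulli-suc m = cong (λ s → - (invℕ (suc (suc m)) * s)) (begin
  sumℚ (zipWith g (upTo (suc m)) (firstB (suc m)))               ≡⟨ cong (λ l → sumℚ (zipWith g (upTo (suc m)) l)) (firstB≡map (suc m)) ⟩
  sumℚ (zipWith g (upTo (suc m)) (map bernoulli (upTo (suc m)))) ≡⟨ cong sumℚ (zipWith-mapʳ g bernoulli (upTo (suc m))) ⟩
  sumTo (suc m) (λ k → g k (bernoulli k))                        ≡⟨ sumTo≡∑ (suc m) (λ k → g k (bernoulli k)) ⟩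
  ∑ (suc m) (λ k → g k (bernoulli k))                            ∎)
  where
  open ≡-Reasoning
  g : ℕ → ℚ → ℚ
  g k b = ℕ→ℚ (suc (suc m) C k) * b

[n+1]Cn≡n+1 : ∀ n → suc n C n ≡ suc n
[n+1]Cn≡n+1 n = trans (nCk≡nC[n∸k] (ℕP.n≤1+n n)) (trans (cong (suc n C_) (ℕP.m+n∸n≡m 1 n)) (nC1≡n (suc n)))

bernoulli-recurrence : ∀ m → ∑ (suc (suc m)) (λ k → ℕ→ℚ (suc (suc m) C k) * bernoulli k) ≡ 0ℚ
bernoulli-recurrence m = begin
  s + ℕ→ℚ (suc (suc m) C suc m) * bernoulli (suc m) ≡⟨ cong₂ (λ c b → s + ℕ→ℚ c * b) ([n+1]Cn≡n+1 (suc m)) (bernoulli-suc m) ⟩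
  s + c * - (i * s)   ≡⟨ lemma s c i ⟩
  s - (c * i) * s     ≡⟨ cong (λ u → s - u * s) (invℕ-inverseʳ (suc m)) ⟩
  s - 1ℚ * s          ≡⟨ cancel s ⟩
  0ℚ                  ∎
  where
  open ≡-Reasoning
  s c i : ℚ
  s = ∑ (suc m) (λ k → ℕ→ℚ (suc (suc m) C k) * bernoulli k)
  c = ℕ→ℚ (suc (suc m))
  i = invℕ (suc (suc m))
  lemma : ∀ s c i → s + c * - (i * s) ≡ s - (c * i) * s
  lemma = solve-∀ ℚ-ring
  cancel : ∀ s → s - 1ℚ * s ≡ 0ℚ
  cancel = solve-∀ ℚ-ring

-- The correction in B_n(1) = B_n, which fails only for n = 1, where B_1 = -1/2.
δ₁ : ℕ → ℚ
δ₁ 1 = 1ℚ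
δ₁ _ = 0ℚ

∑-nCk*bernoulli : ∀ n → ∑ (suc n) (λ k → ℕ→ℚ (n C k) * bernoulli k) ≡ bernoulli n + δ₁ n
∑-nCk*bernoulli 0 = refl
∑-nCk*bernoulli 1 = refl
∑-nCk*bernoulli n@(suc (suc m)) = begin
  ∑ n (λ k → ℕ→ℚ (n C k) * bernoulli k) + ℕ→ℚ (n C n) * bernoulli n
    ≡⟨ cong₂ (λ s c → s + ℕ→ℚ c * bernoulli n) (bernoulli-recurrence m) (nCn≡1 n) ⟩
  0ℚ + 1ℚ * bernoulli n ≡⟨ lemma (bernoulli n) ⟩
  bernoulli n + 0ℚ ∎
  where
  open ≡-Reasoning
  lemma : ∀ b → 0ℚ + 1ℚ * b ≡ b + 0ℚ
  lemma = solve-∀ ℚ-ring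

∑-nCk*bernoulli-≤ : ∀ {n N} → n ≤ N → ∑ (suc N) (λ k → ℕ→ℚ (n C k) * bernoulli k) ≡ bernoulli n + δ₁ n
∑-nCk*bernoulli-≤ {n} {N} n≤N = trans
  (cong (λ m → ∑ m (λ k → ℕ→ℚ (n C k) * bernoulli k)) (trans (cong suc (sym (ℕP.m∸n+n≡m n≤N))) (sym (ℕP.+-suc (N ∸ n) n))))
  (trans (∑-extend (suc n) (N ∸ n) _ λ k n<k → ℕ→ℚ-nCk≡0 (bernoulli k) n<k) (∑-nCk*bernoulli n))

bernoulliPoly≡∑ : ∀ n x → bernoulliPoly n x ≡ ∑ (suc n) (λ k → ℕ→ℚ (n C k) * bernoulli k * x ^ℚ (n ∸ k))
bernoulliPoly≡∑ n x = sumTo≡∑ (suc n) _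

-- After expanding the powers of x + 1 and exchanging the sums, the coefficient of C(n,j) x^j is
-- B_{n-j} + `δ₁ (n ∸ j)`. The Bernoulli parts rebuild B_n(x); the correction survives only at j = n
-- - 1.
bernoulliPoly-difference : ∀ n x → bernoulliPoly (suc n) (x + 1ℚ) ≡ bernoulliPoly (suc n) x + ℕ→ℚ (suc n) * x ^ℚ n
bernoulliPoly-difference n-1 x = begin
  bernoulliPoly n (x + 1ℚ)
    ≡⟨ bernoulliPoly≡∑ n (x + 1ℚ) ⟩
  ∑ (suc n) (λ k → ℕ→ℚ (n C k) * bernoulli k * (x + 1ℚ) ^ℚ (n ∸ k))
    ≡⟨ ∑-cong (suc n) (λ k k<1+n → row k (ℕP.≤-pred k<1+n)) ⟩
  ∑ (suc n) (λ k → ∑ (suc n) (λ j → x ^ℚ j * ℕ→ℚ (n C j) * (ℕ→ℚ ((n ∸ j) C k) * bernoulli k)))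
    ≡⟨ ∑-swap (suc n) (suc n) (λ k j → x ^ℚ j * ℕ→ℚ (n C j) * (ℕ→ℚ ((n ∸ j) C k) * bernoulli k)) ⟩
  ∑ (suc n) (λ j → ∑ (suc n) (λ k → x ^ℚ j * ℕ→ℚ (n C j) * (ℕ→ℚ ((n ∸ j) C k) * bernoulli k)))
    ≡⟨ ∑-cong (suc n) (λ j _ → trans (∑-*ˡ (suc n) (x ^ℚ j * ℕ→ℚ (n C j)) (λ k → ℕ→ℚ ((n ∸ j) C k) * bernoulli k))
         (cong (x ^ℚ j * ℕ→ℚ (n C j) *_) (∑-nCk*bernoulli-≤ (ℕP.m∸n≤m n j)))) ⟩
  ∑ (suc n) (λ j → x ^ℚ j * ℕ→ℚ (n C j) * (bernoulli (n ∸ j) + δ₁ (n ∸ j)))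
    -- So far j is the exponent of x; in the definition of the polynomial the index is that of the
    -- Bernoulli number.
    ≡⟨ ∑-reverse (suc n) (λ j → x ^ℚ j * ℕ→ℚ (n C j) * (bernoulli (n ∸ j) + δ₁ (n ∸ j))) ⟩
  ∑ (suc n) (λ k → x ^ℚ (n ∸ k) * ℕ→ℚ (n C (n ∸ k)) * (bernoulli (n ∸ (n ∸ k)) + δ₁ (n ∸ (n ∸ k))))
    ≡⟨ ∑-cong (suc n) (λ k k<1+n → column k (ℕP.≤-pred k<1+n)) ⟩
  ∑ (suc n) (λ k → f k + g k)
    ≡⟨ ∑-+ (suc n) f g ⟩
  ∑ (suc n) f + ∑ (suc n) g
    ≡⟨ cong₂ _+_ (sym (bernoulliPoly≡∑ n x)) ∑g ⟩
  bernoulliPoly n x + ℕ→ℚ n * x ^ℚ n-1 ∎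
  where
  open ≡-Reasoning
  n : ℕ
  n = suc n-1
  f g : ℕ → ℚ
  f k = ℕ→ℚ (n C k) * bernoulli k * x ^ℚ (n ∸ k)
  g k = ℕ→ℚ (n C k) * x ^ℚ (n ∸ k) * δ₁ k
  regroup : ∀ c b d y → c * b * (d * y) ≡ c * d * (y * b)
  regroup = solve-∀ ℚ-ring
  regroup′ : ∀ c b d y → c * d * (y * b) ≡ y * c * (d * b)
  regroup′ = solve-∀ ℚ-ring
  split : ∀ y c b d → y * c * (b + d) ≡ c * b * y + c * y * d
  split = solve-∀ ℚ-ring
  row : ∀ k → k ≤ n → ℕ→ℚ (n C k) * bernoulli k * (x + 1ℚ) ^ℚ (n ∸ k) ≡
    ∑ (suc n) (λ j → x ^ℚ j * ℕ→ℚ (n C j) * (ℕ→ℚ ((n ∸ j) C k) * bernoulli k))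
  row k k≤n = begin
    ℕ→ℚ (n C k) * bernoulli k * (x + 1ℚ) ^ℚ (n ∸ k)
      ≡⟨ cong (ℕ→ℚ (n C k) * bernoulli k *_) (binomial-theorem-≤ x (ℕP.m∸n≤m n k)) ⟩
    ℕ→ℚ (n C k) * bernoulli k * ∑ (suc n) (λ j → ℕ→ℚ ((n ∸ k) C j) * x ^ℚ j)
      ≡⟨ ∑-*ˡ (suc n) (ℕ→ℚ (n C k) * bernoulli k) (λ j → ℕ→ℚ ((n ∸ k) C j) * x ^ℚ j) ⟨
    ∑ (suc n) (λ j → ℕ→ℚ (n C k) * bernoulli k * (ℕ→ℚ ((n ∸ k) C j) * x ^ℚ j))
      ≡⟨ ∑-cong (suc n) (λ j j<1+n → begin
        ℕ→ℚ (n C k) * bernoulli k * (ℕ→ℚ ((n ∸ k) C j) * x ^ℚ j)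
          ≡⟨ regroup (ℕ→ℚ (n C k)) (bernoulli k) (ℕ→ℚ ((n ∸ k) C j)) (x ^ℚ j) ⟩
        ℕ→ℚ (n C k) * ℕ→ℚ ((n ∸ k) C j) * (x ^ℚ j * bernoulli k)
          ≡⟨ cong (_* (x ^ℚ j * bernoulli k)) (begin
            ℕ→ℚ (n C k) * ℕ→ℚ ((n ∸ k) C j)   ≡⟨ ℕ→ℚ-* (n C k) ((n ∸ k) C j) ⟨
            ℕ→ℚ ((n C k) ℕ.* ((n ∸ k) C j))   ≡⟨ cong ℕ→ℚ (nCk*[n∸k]Cj≡nCj*[n∸j]Ck k≤n (ℕP.≤-pred j<1+n)) ⟩
            ℕ→ℚ ((n C j) ℕ.* ((n ∸ j) C k))   ≡⟨ ℕ→ℚ-* (n C j) ((n ∸ j) C k) ⟩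
            ℕ→ℚ (n C j) * ℕ→ℚ ((n ∸ j) C k)   ∎) ⟩
        ℕ→ℚ (n C j) * ℕ→ℚ ((n ∸ j) C k) * (x ^ℚ j * bernoulli k)
          ≡⟨ regroup′ (ℕ→ℚ (n C j)) (bernoulli k) (ℕ→ℚ ((n ∸ j) C k)) (x ^ℚ j) ⟩
        x ^ℚ j * ℕ→ℚ (n C j) * (ℕ→ℚ ((n ∸ j) C k) * bernoulli k) ∎) ⟩
    ∑ (suc n) (λ j → x ^ℚ j * ℕ→ℚ (n C j) * (ℕ→ℚ ((n ∸ j) C k) * bernoulli k)) ∎
  column : ∀ k → k ≤ n → x ^ℚ (n ∸ k) * ℕ→ℚ (n C (n ∸ k)) * (bernoulli (n ∸ (n ∸ k)) + δ₁ (n ∸ (n ∸ k))) ≡ f k + g k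
  column k k≤n = begin
    x ^ℚ (n ∸ k) * ℕ→ℚ (n C (n ∸ k)) * (bernoulli (n ∸ (n ∸ k)) + δ₁ (n ∸ (n ∸ k)))
      ≡⟨ cong₂ (λ c i → x ^ℚ (n ∸ k) * ℕ→ℚ c * (bernoulli i + δ₁ i)) (sym (nCk≡nC[n∸k] k≤n)) (ℕP.m∸[m∸n]≡n k≤n) ⟩
    x ^ℚ (n ∸ k) * ℕ→ℚ (n C k) * (bernoulli k + δ₁ k)
      ≡⟨ split (x ^ℚ (n ∸ k)) (ℕ→ℚ (n C k)) (bernoulli k) (δ₁ k) ⟩
    f k + g k ∎
  ∑g : ∑ (suc n) g ≡ ℕ→ℚ n * x ^ℚ n-1
  ∑g = begin
    ∑ (suc n) g                         ≡⟨ ∑-head n g ⟩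
    g 0 + ∑ n (g ∘ suc)                 ≡⟨ cong (g 0 +_) (∑-head n-1 (g ∘ suc)) ⟩
    g 0 + (g 1 + ∑ n-1 (g ∘ suc ∘ suc)) ≡⟨ cong (λ s → g 0 + (g 1 + s)) (trans (∑-cong n-1 (λ k _ → ℚP.*-zeroʳ (ℕ→ℚ (n C suc (suc k)) * x ^ℚ (n ∸ suc (suc k))))) (∑-0 n-1)) ⟩
    g 0 + (g 1 + 0ℚ)                    ≡⟨ simplify (ℕ→ℚ (n C 0) * x ^ℚ n) (ℕ→ℚ (n C 1) * x ^ℚ n-1) ⟩
    ℕ→ℚ (n C 1) * x ^ℚ n-1              ≡⟨ cong (λ c → ℕ→ℚ c * x ^ℚ n-1) (nC1≡n n) ⟩
    ℕ→ℚ n * x ^ℚ n-1                    ∎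
    where
    simplify : ∀ a b → a * 0ℚ + (b * 1ℚ + 0ℚ) ≡ b
    simplify = solve-∀ ℚ-ring

invℕ-inverseʳ′ : ∀ k → (ℕ→ℚ k + 1ℚ) * invℕ (suc k) ≡ 1ℚ
invℕ-inverseʳ′ k = trans (cong (_* invℕ (suc k)) (sym (ℕ→ℚ-suc k))) (invℕ-inverseʳ k)

ℕ→ℚ-odd : ∀ k → ℕ→ℚ (2 ℕ.* k ℕ.+ 1) ≡ 2ℚ * ℕ→ℚ k + 1ℚ
ℕ→ℚ-odd k = trans (ℕ→ℚ-+ (2 ℕ.* k) 1) (cong (_+ 1ℚ) (ℕ→ℚ-* 2 k))

invℕ-odd : ∀ k → (2ℚ * ℕ→ℚ k + 1ℚ) * invℕ (2 ℕ.* k ℕ.+ 1) ≡ 1ℚ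
invℕ-odd k = trans (cong (_* invℕ (2 ℕ.* k ℕ.+ 1)) (sym (ℕ→ℚ-odd k)))
  (subst (λ m → ℕ→ℚ m * invℕ m ≡ 1ℚ) (ℕP.+-comm 1 (2 ℕ.* k)) (invℕ-inverseʳ (2 ℕ.* k)))

-- Telescoping identities

-- This is (-1)^k C(x,k) C(x+k,k): up to the factor (-1)^k/k!² it is the product of the 2k
-- consecutive numbers from x - k + 1 to x + k.
binom² : ℕ → ℚ → ℚ
binom² k x = binomℚ x k * binomℚ (- 1ℚ - x) k

binom²-suc : ∀ k x → binom² (suc k) x ≡
  binom² k x * ((x - ℕ→ℚ k) * (- 1ℚ - x - ℕ→ℚ k) * (invℕ (suc k) * invℕ (suc k)))
binom²-suc k x = trans (cong₂ _*_ (binomℚ-suc x k) (binomℚ-suc (- 1ℚ - x) k))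
  (lemma (binomℚ x k) (binomℚ (- 1ℚ - x) k) (x - ℕ→ℚ k) (- 1ℚ - x - ℕ→ℚ k) (invℕ (suc k)))
  where
  lemma : ∀ a b u v i → a * (u * i) * (b * (v * i)) ≡ a * b * (u * v * (i * i))
  lemma = solve-∀ ℚ-ring

reflect-involutive : ∀ x → - 1ℚ - (- 1ℚ - x) ≡ x
reflect-involutive = solve-∀ ℚ-ring

binom²-reflect : ∀ k x → binom² k (- 1ℚ - x) ≡ binom² k x
binom²-reflect k x = trans (cong (λ y → binomℚ (- 1ℚ - x) k * binomℚ y k) (reflect-involutive x))
  (ℚP.*-comm (binomℚ (- 1ℚ - x) k) (binomℚ x k))

∏ : ℕ → ℚ → ℚ
∏ zero    x = 1ℚ
∏ (suc k) x = ∏ k x * (1ℚ - x * x * (invℕ (suc k) * invℕ (suc k)))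

-- The factor x - k completes the 2k consecutive numbers in `binom²` to the range from x - k to x +
-- k. This is symmetric about x, and (x - i)(x + i) = x² - i² pairs it off.
[x-k]*binom² : ∀ k x → (x - ℕ→ℚ k) * binom² k x ≡ x * ∏ k x
[x-k]*binom² zero    x = base x
  where
  base : ∀ x → (x - 0ℚ) * 1ℚ ≡ x * 1ℚ
  base = solve-∀ ℚ-ring
[x-k]*binom² (suc k) x = begin
  (x - ℕ→ℚ (suc k)) * binom² (suc k) x
    ≡⟨ cong₂ (λ κ b → (x - κ) * b) (ℕ→ℚ-suc k) (binom²-suc k x) ⟩
  (x - (ℕ→ℚ k + 1ℚ)) * (binom² k x * ((x - ℕ→ℚ k) * (- 1ℚ - x - ℕ→ℚ k) * (i * i)))
    -- The ring solver sees `i` as a free variable, so products (k+1)·i are kept intact here and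
    -- replaced by 1 afterwards.
    ≡⟨ factor x (ℕ→ℚ k) (binom² k x) i ⟩
  (x - ℕ→ℚ k) * binom² k x * ((ℕ→ℚ k + 1ℚ) * i * ((ℕ→ℚ k + 1ℚ) * i) - x * x * (i * i))
    ≡⟨ cong₂ (λ b e → b * (e * e - x * x * (i * i))) ([x-k]*binom² k x) (invℕ-inverseʳ′ k) ⟩
  x * ∏ k x * (1ℚ * 1ℚ - x * x * (i * i))
    ≡⟨ tidy x (∏ k x) i ⟩
  x * ∏ (suc k) x ∎
  where
  open ≡-Reasoning
  i : ℚ
  i = invℕ (suc k)
  factor : ∀ x κ b i → (x - (κ + 1ℚ)) * (b * ((x - κ) * (- 1ℚ - x - κ) * (i * i))) ≡
    (x - κ) * b * ((κ + 1ℚ) * i * ((κ + 1ℚ) * i) - x * x * (i * i))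
  factor = solve-∀ ℚ-ring
  tidy : ∀ x t i → x * t * (1ℚ * 1ℚ - x * x * (i * i)) ≡ x * (t * (1ℚ - x * x * (i * i)))
  tidy = solve-∀ ℚ-ring

-- Completing the same 2k numbers at the other end gives a range symmetric about x + 1.
[x+1+k]*binom² : ∀ k x → (x + 1ℚ + ℕ→ℚ k) * binom² k x ≡ (x + 1ℚ) * ∏ k (x + 1ℚ)
[x+1+k]*binom² zero    x = base x
  where
  base : ∀ x → (x + 1ℚ + 0ℚ) * 1ℚ ≡ (x + 1ℚ) * 1ℚ
  base = solve-∀ ℚ-ring
[x+1+k]*binom² (suc k) x = begin
  (x + 1ℚ + ℕ→ℚ (suc k)) * binom² (suc k) x
    ≡⟨ cong₂ (λ κ b → (x + 1ℚ + κ) * b) (ℕ→ℚ-suc k) (binom²-suc k x) ⟩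
  (x + 1ℚ + (ℕ→ℚ k + 1ℚ)) * (binom² k x * ((x - ℕ→ℚ k) * (- 1ℚ - x - ℕ→ℚ k) * (i * i)))
    ≡⟨ factor x (ℕ→ℚ k) (binom² k x) i ⟩
  (x + 1ℚ + ℕ→ℚ k) * binom² k x * ((ℕ→ℚ k + 1ℚ) * i * ((ℕ→ℚ k + 1ℚ) * i) - (x + 1ℚ) * (x + 1ℚ) * (i * i))
    ≡⟨ cong₂ (λ b e → b * (e * e - (x + 1ℚ) * (x + 1ℚ) * (i * i))) ([x+1+k]*binom² k x) (invℕ-inverseʳ′ k) ⟩
  (x + 1ℚ) * ∏ k (x + 1ℚ) * (1ℚ * 1ℚ - (x + 1ℚ) * (x + 1ℚ) * (i * i))
    ≡⟨ tidy (x + 1ℚ) (∏ k (x + 1ℚ)) i ⟩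
  (x + 1ℚ) * ∏ (suc k) (x + 1ℚ) ∎
  where
  open ≡-Reasoning
  i : ℚ
  i = invℕ (suc k)
  factor : ∀ x κ b i → (x + 1ℚ + (κ + 1ℚ)) * (b * ((x - κ) * (- 1ℚ - x - κ) * (i * i))) ≡
    (x + 1ℚ + κ) * b * ((κ + 1ℚ) * i * ((κ + 1ℚ) * i) - (x + 1ℚ) * (x + 1ℚ) * (i * i))
  factor = solve-∀ ℚ-ring
  tidy : ∀ x t i → x * t * (1ℚ * 1ℚ - x * x * (i * i)) ≡ x * (t * (1ℚ - x * x * (i * i)))
  tidy = solve-∀ ℚ-ring

-- Displays the factor x, which at x = pt is the p that compensates the weight 1/p.
binom²-∏ : ∀ k x → binom² (suc k) x ≡
  - (x * (x + (ℕ→ℚ k + 1ℚ)) * ∏ k x * (invℕ (suc k) * invℕ (suc k)))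
binom²-∏ k x = begin
  binom² (suc k) x                                ≡⟨ binom²-suc k x ⟩
  binom² k x * ((x - ℕ→ℚ k) * (- 1ℚ - x - ℕ→ℚ k) * (i * i)) ≡⟨ isolate (binom² k x) x (ℕ→ℚ k) (i * i) ⟩
  - ((x - ℕ→ℚ k) * binom² k x * (x + (ℕ→ℚ k + 1ℚ)) * (i * i))
    ≡⟨ cong (λ b → - (b * (x + (ℕ→ℚ k + 1ℚ)) * (i * i))) ([x-k]*binom² k x) ⟩
  - (x * ∏ k x * (x + (ℕ→ℚ k + 1ℚ)) * (i * i))    ≡⟨ reorder x (∏ k x) (x + (ℕ→ℚ k + 1ℚ)) (i * i) ⟩
  - (x * (x + (ℕ→ℚ k + 1ℚ)) * ∏ k x * (i * i))    ∎
  where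
  open ≡-Reasoning
  i : ℚ
  i = invℕ (suc k)
  isolate : ∀ b x κ j → b * ((x - κ) * (- 1ℚ - x - κ) * j) ≡ - ((x - κ) * b * (x + (κ + 1ℚ)) * j)
  isolate = solve-∀ ℚ-ring
  reorder : ∀ x t y j → - (x * t * y * j) ≡ - (x * y * t * j)
  reorder = solve-∀ ℚ-ring

-- The companion of `binom²-∏` with `∏` taken at x + 1: in the difference of the sum, the summands
-- at x and at x + 1 then share the factor `∏ k (x + 1ℚ)`.
binom²-∏′ : ∀ k x → binom² (suc k) x ≡
  - ((x + 1ℚ) * ∏ k (x + 1ℚ) * (x - ℕ→ℚ k) * (invℕ (suc k) * invℕ (suc k)))
binom²-∏′ k x = begin
  binom² (suc k) x                                ≡⟨ binom²-suc k x ⟩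
  binom² k x * ((x - ℕ→ℚ k) * (- 1ℚ - x - ℕ→ℚ k) * (i * i)) ≡⟨ isolate (binom² k x) x (ℕ→ℚ k) (i * i) ⟩
  - ((x + 1ℚ + ℕ→ℚ k) * binom² k x * (x - ℕ→ℚ k) * (i * i))
    ≡⟨ cong (λ b → - (b * (x - ℕ→ℚ k) * (i * i))) ([x+1+k]*binom² k x) ⟩
  - ((x + 1ℚ) * ∏ k (x + 1ℚ) * (x - ℕ→ℚ k) * (i * i))    ∎
  where
  open ≡-Reasoning
  i : ℚ
  i = invℕ (suc k)
  isolate : ∀ b x κ j → b * ((x - κ) * (- 1ℚ - x - κ) * j) ≡ - ((x + 1ℚ + κ) * b * (x - κ) * j)
  isolate = solve-∀ ℚ-ring

-- The two completing factors differ by (x + 1 + n) - (x - n) = 2n + 1, which is p in the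
-- application.
[x+1]*∏-step : ∀ n x → (x + 1ℚ) * ∏ n (x + 1ℚ) ≡ x * ∏ n x + (2ℚ * ℕ→ℚ n + 1ℚ) * binom² n x
[x+1]*∏-step n x = begin
  (x + 1ℚ) * ∏ n (x + 1ℚ)          ≡⟨ [x+1+k]*binom² n x ⟨
  (x + 1ℚ + ℕ→ℚ n) * binom² n x    ≡⟨ lemma x (ℕ→ℚ n) (binom² n x) ⟩
  (x - ℕ→ℚ n) * binom² n x + (2ℚ * ℕ→ℚ n + 1ℚ) * binom² n x
    ≡⟨ cong (_+ (2ℚ * ℕ→ℚ n + 1ℚ) * binom² n x) ([x-k]*binom² n x) ⟩
  x * ∏ n x + (2ℚ * ℕ→ℚ n + 1ℚ) * binom² n x ∎
  where
  open ≡-Reasoning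
  lemma : ∀ x ν b → (x + 1ℚ + ν) * b ≡ (x - ν) * b + (2ℚ * ν + 1ℚ) * b
  lemma = solve-∀ ℚ-ring

binomSummand : ℚ → ℕ → ℚ
binomSummand x k = binom² k x * ((2ℚ * x + 1ℚ) * invℕ (2 ℕ.* k ℕ.+ 1))

binomSum : ℕ → ℚ → ℚ
binomSum n x = ∑ (suc n) (binomSummand x)

binomSum-reflect : ∀ n x → binomSum n (- 1ℚ - x) ≡ - binomSum n x
binomSum-reflect n x = trans
  (∑-cong (suc n) λ k _ → trans (cong (_* ((2ℚ * (- 1ℚ - x) + 1ℚ) * invℕ (2 ℕ.* k ℕ.+ 1))) (binom²-reflect k x))
    (lemma (binom² k x) x (invℕ (2 ℕ.* k ℕ.+ 1))))
  (∑-neg (suc n) (binomSummand x))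
  where
  lemma : ∀ b x g → b * ((2ℚ * (- 1ℚ - x) + 1ℚ) * g) ≡ - (b * ((2ℚ * x + 1ℚ) * g))
  lemma = solve-∀ ℚ-ring

-- With the weight (2x+1)/(2k+1), passing from x to x + 1 changes the k-th summand by exactly 2(T_k
-- - T_{k-1}) at x + 1, where T_k is `∏ k`. The sum over k therefore collapses; the summand k = 0
-- contributes 2 = 2 T_0.
binomSum-difference : ∀ n x → binomSum n (x + 1ℚ) ≡ binomSum n x + 2ℚ * ∏ n (x + 1ℚ)
binomSum-difference zero    x = base x
  where
  base : ∀ x → 0ℚ + 1ℚ * ((2ℚ * (x + 1ℚ) + 1ℚ) * 1ℚ) ≡
    0ℚ + 1ℚ * ((2ℚ * x + 1ℚ) * 1ℚ) + 2ℚ * 1ℚ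
  base = solve-∀ ℚ-ring
binomSum-difference (suc n) x = begin
  binomSum n y + binom² (suc n) y * ((2ℚ * y + 1ℚ) * g)
    ≡⟨ cong₂ (λ s b → s + b * ((2ℚ * y + 1ℚ) * g)) (binomSum-difference n x) (binom²-∏ n y) ⟩
  binomSum n x + 2ℚ * t + - (y * (y + (ℕ→ℚ n + 1ℚ)) * t * (i * i)) * ((2ℚ * y + 1ℚ) * g)
    ≡⟨ factor (binomSum n x) x t (ℕ→ℚ n) i g ⟩
  binomSum n x + - (y * t * (x - ℕ→ℚ n) * (i * i)) * ((2ℚ * x + 1ℚ) * g)
    + 2ℚ * (t * (1ℚ - y * y * (i * i) * ((2ℚ * (ℕ→ℚ n + 1ℚ) + 1ℚ) * g)))
    ≡⟨ cong₂ (λ b e → binomSum n x + b * ((2ℚ * x + 1ℚ) * g) + 2ℚ * (t * (1ℚ - y * y * (i * i) * e)))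
         (sym (binom²-∏′ n x)) (trans (cong (λ m → (2ℚ * m + 1ℚ) * g) (sym (ℕ→ℚ-suc n))) (invℕ-odd (suc n))) ⟩
  binomSum (suc n) x + 2ℚ * (t * (1ℚ - y * y * (i * i) * 1ℚ))
    ≡⟨ cong (λ j → binomSum (suc n) x + 2ℚ * (t * (1ℚ - j))) (ℚP.*-identityʳ (y * y * (i * i))) ⟩
  binomSum (suc n) x + 2ℚ * ∏ (suc n) y ∎
  where
  open ≡-Reasoning
  y i g t : ℚ
  y = x + 1ℚ
  i = invℕ (suc n)
  g = invℕ (2 ℕ.* suc n ℕ.+ 1)
  t = ∏ n y
  factor : ∀ s x t ν i g →
    s + 2ℚ * t + - ((x + 1ℚ) * ((x + 1ℚ) + (ν + 1ℚ)) * t * (i * i)) * ((2ℚ * (x + 1ℚ) + 1ℚ) * g) ≡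
    s + - ((x + 1ℚ) * t * (x - ν) * (i * i)) * ((2ℚ * x + 1ℚ) * g)
      + 2ℚ * (t * (1ℚ - (x + 1ℚ) * (x + 1ℚ) * (i * i) * ((2ℚ * (ν + 1ℚ) + 1ℚ) * g)))
  factor = solve-∀ ℚ-ring

-- Harmonic numbers

H : ℕ → ℚ
H n = ∑ n (λ k → invℕ (suc k))

[2+2n]⁻¹ : ∀ n → invℕ (suc (suc (2 ℕ.* n))) + invℕ (suc (suc (2 ℕ.* n))) ≡ invℕ (suc n)
[2+2n]⁻¹ n = begin
  invℕ (suc (suc (2 ℕ.* n))) + invℕ (suc (suc (2 ℕ.* n))) ≡⟨ cong (λ m → invℕ m + invℕ m) (ℕP.*-suc 2 n) ⟨
  invℕ (2 ℕ.* suc n) + invℕ (2 ℕ.* suc n) ≡⟨ cong (λ y → y + y) (invℕ-* 1 n) ⟩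
  invℕ 2 * invℕ (suc n) + invℕ 2 * invℕ (suc n) ≡⟨ ℚP.*-distribʳ-+ (invℕ (suc n)) (invℕ 2) (invℕ 2) ⟨
  1ℚ * invℕ (suc n) ≡⟨ ℚP.*-identityˡ (invℕ (suc n)) ⟩
  invℕ (suc n) ∎
  where open ≡-Reasoning

-- From 1/(k(2k+1)) = 1/k - 2/(2k+1), where the odd reciprocals from 1/3 to 1/(2n+1) add up to
-- H_{2n+1} - H_n/2 - 1.
∑-invℕ*invℕ-odd : ∀ n → ∑ n (λ k → invℕ (suc k) * invℕ (2 ℕ.* suc k ℕ.+ 1)) ≡
  2ℚ * (H n - H (suc (2 ℕ.* n)) + 1ℚ)
∑-invℕ*invℕ-odd zero    = refl
∑-invℕ*invℕ-odd (suc n) = begin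
  ∑ n (λ k → invℕ (suc k) * invℕ (2 ℕ.* suc k ℕ.+ 1)) + i * g
    ≡⟨ cong₂ _+_ (∑-invℕ*invℕ-odd n) partial-fractions ⟩
  2ℚ * (H n - h + 1ℚ) + (i - 2ℚ * g)
    ≡⟨ cong (λ y → 2ℚ * (H n - h + 1ℚ) + (y - 2ℚ * g)) (sym ([2+2n]⁻¹ n)) ⟩
  2ℚ * (H n - h + 1ℚ) + (j + j - 2ℚ * g)
    ≡⟨ collect (H n) h j g ⟩
  2ℚ * (H n + (j + j) - (h + j + g) + 1ℚ)
    ≡⟨ cong (λ y → 2ℚ * (H n + y - (h + j + g) + 1ℚ)) ([2+2n]⁻¹ n) ⟩
  2ℚ * (H (suc n) - (h + j + g) + 1ℚ)
    ≡⟨ cong (λ y → 2ℚ * (H (suc n) - (h + j + y) + 1ℚ)) (cong invℕ (trans (ℕP.+-comm (2 ℕ.* suc n) 1) (cong suc (ℕP.*-suc 2 n)))) ⟩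
  2ℚ * (H (suc n) - H (3 ℕ.+ 2 ℕ.* n) + 1ℚ)
    ≡⟨ cong (λ m → 2ℚ * (H (suc n) - H (suc m) + 1ℚ)) (ℕP.*-suc 2 n) ⟨
  2ℚ * (H (suc n) - H (suc (2 ℕ.* suc n)) + 1ℚ) ∎
  where
  open ≡-Reasoning
  i g j h m : ℚ
  i = invℕ (suc n)
  g = invℕ (2 ℕ.* suc n ℕ.+ 1)
  j = invℕ (suc (suc (2 ℕ.* n)))
  h = H (suc (2 ℕ.* n))
  m = ℕ→ℚ (suc n)
  collect : ∀ a h j g → 2ℚ * (a - h + 1ℚ) + (j + j - 2ℚ * g) ≡
    2ℚ * (a + (j + j) - (h + j + g) + 1ℚ)
  collect = solve-∀ ℚ-ring
  expand : ∀ i g m → i * ((2ℚ * m + 1ℚ) * g) - 2ℚ * (m * i) * g ≡ i * g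
  expand = solve-∀ ℚ-ring
  tidy : ∀ i g → i * 1ℚ - 2ℚ * 1ℚ * g ≡ i - 2ℚ * g
  tidy = solve-∀ ℚ-ring
  partial-fractions : i * g ≡ i - 2ℚ * g
  partial-fractions = begin
    i * g                                        ≡⟨ expand i g m ⟨
    i * ((2ℚ * m + 1ℚ) * g) - 2ℚ * (m * i) * g   ≡⟨ cong₂ (λ a b → i * a - 2ℚ * b * g) (invℕ-odd (suc n)) (invℕ-inverseʳ n) ⟩
    i * 1ℚ - 2ℚ * 1ℚ * g                         ≡⟨ tidy i g ⟩
    i - 2ℚ * g                                   ∎

[-1]^2n≡1 : ∀ n → (- 1ℚ) ^ℚ (2 ℕ.* n) ≡ 1ℚ
[-1]^2n≡1 zero    = refl
[-1]^2n≡1 (suc n) = trans (cong ((- 1ℚ) ^ℚ_) (ℕP.*-suc 2 n))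
  (trans (lemma ((- 1ℚ) ^ℚ (2 ℕ.* n))) ([-1]^2n≡1 n))
  where
  lemma : ∀ y → - 1ℚ * (- 1ℚ * y) ≡ y
  lemma = solve-∀ ℚ-ring

-- The alternating sum is H_{2n} less twice the reciprocals of the even numbers up to 2n, and these
-- sum to H_n/2.
∑-alternating-invℕ : ∀ n → ∑ (2 ℕ.* n) (λ k → (- 1ℚ) ^ℚ k * invℕ (suc k)) ≡ H (2 ℕ.* n) - H n
∑-alternating-invℕ zero    = refl
∑-alternating-invℕ (suc n) = begin
  ∑ (2 ℕ.* suc n) f                             ≡⟨ cong (λ m → ∑ m f) (ℕP.*-suc 2 n) ⟩
  ∑ (2 ℕ.* n) f + s * i + - 1ℚ * s * j          ≡⟨ cong₂ (λ a b → a + b * i + - 1ℚ * b * j) (∑-alternating-invℕ n) ([-1]^2n≡1 n) ⟩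
  H (2 ℕ.* n) - H n + 1ℚ * i + - 1ℚ * 1ℚ * j    ≡⟨ lemma (H (2 ℕ.* n)) (H n) i j ⟩
  H (2 ℕ.* n) + i + j - (H n + (j + j))         ≡⟨ cong (λ y → H (2 ℕ.* n) + i + j - (H n + y)) ([2+2n]⁻¹ n) ⟩
  H (2 ℕ.+ 2 ℕ.* n) - H (suc n)                 ≡⟨ cong (λ m → H m - H (suc n)) (ℕP.*-suc 2 n) ⟨
  H (2 ℕ.* suc n) - H (suc n)                   ∎
  where
  open ≡-Reasoning
  f : ℕ → ℚ
  f k = (- 1ℚ) ^ℚ k * invℕ (suc k)
  s i j : ℚ
  s = (- 1ℚ) ^ℚ (2 ℕ.* n)
  i = invℕ (suc (2 ℕ.* n))
  j = invℕ (suc (suc (2 ℕ.* n)))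
  lemma : ∀ a b i j → a - b + 1ℚ * i + - 1ℚ * 1ℚ * j ≡ a + i + j - (b + (j + j))
  lemma = solve-∀ ℚ-ring

-- Inner binomial coefficients and the Fermat quotient of 2

[n+1]C[k+1]≡[n+1]*nCk/[k+1] : ∀ {n k} → k ≤ n → ℕ→ℚ (suc n C suc k) ≡ ℕ→ℚ (suc n) * (ℕ→ℚ (n C k) * invℕ (suc k))
[n+1]C[k+1]≡[n+1]*nCk/[k+1] {n} {k} k≤n = begin
  c                       ≡⟨ ℚP.*-identityʳ c ⟨
  c * 1ℚ                  ≡⟨ cong (c *_) (invℕ-inverseʳ k) ⟨
  c * (κ * i)             ≡⟨ lemma₁ c κ i ⟩
  κ * c * i               ≡⟨ cong (_* i) (ℕ→ℚ-* (suc k) (suc n C suc k)) ⟨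
  ℕ→ℚ (suc k ℕ.* (suc n C suc k)) * i ≡⟨ cong (λ a → ℕ→ℚ a * i) ([k+1]*[n+1]C[k+1]≡[n+1]*nCk k≤n) ⟩
  ℕ→ℚ (suc n ℕ.* (n C k)) * i         ≡⟨ cong (_* i) (ℕ→ℚ-* (suc n) (n C k)) ⟩
  ℕ→ℚ (suc n) * ℕ→ℚ (n C k) * i       ≡⟨ ℚP.*-assoc (ℕ→ℚ (suc n)) (ℕ→ℚ (n C k)) i ⟩
  ℕ→ℚ (suc n) * (ℕ→ℚ (n C k) * i)     ∎
  where
  open ≡-Reasoning
  c κ i : ℚ
  c = ℕ→ℚ (suc n C suc k)
  κ = ℕ→ℚ (suc k)
  i = invℕ (suc k)
  lemma₁ : ∀ c κ i → c * (κ * i) ≡ κ * c * i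
  lemma₁ = solve-∀ ℚ-ring

-- Splitting off both end terms leaves coefficients with the common factor n + 1. For n + 1 = p this
-- yields the Fermat quotient at x = 1 and the additivity of the p-th power modulo p for general x.
binomial-theorem-inner : ∀ n x → (x + 1ℚ) ^ℚ suc n ≡
  1ℚ + ℕ→ℚ (suc n) * ∑ n (λ k → ℕ→ℚ (n C k) * invℕ (suc k) * x ^ℚ suc k) + x ^ℚ suc n
binomial-theorem-inner n x = begin
  (x + 1ℚ) ^ℚ suc n ≡⟨ binomial-theorem (suc n) x ⟩
  ∑ (suc n) f + f (suc n) ≡⟨ cong₂ _+_ (∑-head n f) (trans (cong (λ c → ℕ→ℚ c * x ^ℚ suc n) (nCn≡1 (suc n))) (ℚP.*-identityˡ (x ^ℚ suc n))) ⟩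
  1ℚ + ∑ n (f ∘ suc) + x ^ℚ suc n ≡⟨ cong (λ s → 1ℚ + s + x ^ℚ suc n) (trans (∑-cong n term) (∑-*ˡ n (ℕ→ℚ (suc n)) g)) ⟩
  1ℚ + ℕ→ℚ (suc n) * ∑ n g + x ^ℚ suc n ∎
  where
  open ≡-Reasoning
  f g : ℕ → ℚ
  f k = ℕ→ℚ (suc n C k) * x ^ℚ k
  g k = ℕ→ℚ (n C k) * invℕ (suc k) * x ^ℚ suc k
  term : ∀ k → k < n → f (suc k) ≡ ℕ→ℚ (suc n) * g k
  term k k<n = trans (cong (_* x ^ℚ suc k) ([n+1]C[k+1]≡[n+1]*nCk/[k+1] (ℕP.<⇒≤ k<n)))
    (ℚP.*-assoc (ℕ→ℚ (suc n)) (ℕ→ℚ (n C k) * invℕ (suc k)) (x ^ℚ suc k))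

1^n≡1 : ∀ n → 1ℚ ^ℚ n ≡ 1ℚ
1^n≡1 zero    = refl
1^n≡1 (suc n) = trans (ℚP.*-identityˡ (1ℚ ^ℚ n)) (1^n≡1 n)

ℕ→ℚ-^ : ∀ m n → ℕ→ℚ (m ℕ.^ n) ≡ ℕ→ℚ m ^ℚ n
ℕ→ℚ-^ m zero    = refl
ℕ→ℚ-^ m (suc n) = trans (ℕ→ℚ-* m (m ℕ.^ n)) (cong (ℕ→ℚ m *_) (ℕ→ℚ-^ m n))

-- With p = n + 1, the left side is (2^p - 2)/p: the inner coefficients C(p,k+1) added up and
-- divided by p.
2*fermatQuot2 : ∀ n → 2ℚ * fermatQuot2 (suc n) ≡ ∑ n (λ k → ℕ→ℚ (n C k) * invℕ (suc k))
2*fermatQuot2 n = begin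
  2ℚ * ((ℕ→ℚ (2 ℕ.^ n) - 1ℚ) * i)          ≡⟨ cong (λ y → 2ℚ * ((y - 1ℚ) * i)) (ℕ→ℚ-^ 2 n) ⟩
  2ℚ * ((2ℚ ^ℚ n - 1ℚ) * i)                ≡⟨ lemma₁ (2ℚ ^ℚ n) i ⟩
  (2ℚ ^ℚ suc n - 1ℚ - 1ℚ) * i              ≡⟨ cong (λ y → (y - 1ℚ - 1ℚ) * i) (binomial-theorem-inner n 1ℚ) ⟩
  (1ℚ + P * s + 1ℚ ^ℚ suc n - 1ℚ - 1ℚ) * i ≡⟨ cong (λ y → (1ℚ + P * s + y - 1ℚ - 1ℚ) * i) (1^n≡1 (suc n)) ⟩
  (1ℚ + P * s + 1ℚ - 1ℚ - 1ℚ) * i          ≡⟨ lemma₂ P s i ⟩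
  P * i * s                                ≡⟨ cong (_* s) (invℕ-inverseʳ n) ⟩
  1ℚ * s                                   ≡⟨ ℚP.*-identityˡ s ⟩
  s                                        ≡⟨ ∑-cong n (λ k _ → trans (cong (ℕ→ℚ (n C k) * invℕ (suc k) *_) (1^n≡1 (suc k))) (ℚP.*-identityʳ (ℕ→ℚ (n C k) * invℕ (suc k)))) ⟩
  ∑ n (λ k → ℕ→ℚ (n C k) * invℕ (suc k))   ∎
  where
  open ≡-Reasoning
  i P s : ℚ
  i = invℕ (suc n)
  P = ℕ→ℚ (suc n)
  s = ∑ n (λ k → ℕ→ℚ (n C k) * invℕ (suc k) * 1ℚ ^ℚ suc k)
  lemma₁ : ∀ y i → 2ℚ * ((y - 1ℚ) * i) ≡ (2ℚ * y - 1ℚ - 1ℚ) * i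
  lemma₁ = solve-∀ ℚ-ring
  lemma₂ : ∀ P s i → (1ℚ + P * s + 1ℚ - 1ℚ - 1ℚ) * i ≡ P * i * s
  lemma₂ = solve-∀ ℚ-ring

-- Bernoulli polynomials without constant term, and the sum without its prefactor

bernoulliPoly-bernoulli : ∀ n x → bernoulliPoly n x - bernoulli n ≡ ∑ n (λ k → ℕ→ℚ (n C k) * bernoulli k * x ^ℚ (n ∸ k))
bernoulliPoly-bernoulli n x = begin
  bernoulliPoly n x - bernoulli n ≡⟨ cong (_- bernoulli n) (bernoulliPoly≡∑ n x) ⟩
  s + ℕ→ℚ (n C n) * bernoulli n * x ^ℚ (n ∸ n) - bernoulli n
    ≡⟨ cong₂ (λ c e → s + ℕ→ℚ c * bernoulli n * x ^ℚ e - bernoulli n) (nCn≡1 n) (ℕP.n∸n≡0 n) ⟩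
  s + 1ℚ * bernoulli n * 1ℚ - bernoulli n ≡⟨ lemma s (bernoulli n) ⟩
  s ∎
  where
  open ≡-Reasoning
  s : ℚ
  s = ∑ n (λ k → ℕ→ℚ (n C k) * bernoulli k * x ^ℚ (n ∸ k))
  lemma : ∀ s b → s + 1ℚ * b * 1ℚ - b ≡ s
  lemma = solve-∀ ℚ-ring

bernoulliPoly-0 : ∀ n → bernoulliPoly n 0ℚ - bernoulli n ≡ 0ℚ
bernoulliPoly-0 n = trans (bernoulliPoly-bernoulli n 0ℚ) (trans (∑-cong n vanish) (∑-0 n))
  where
  0^ : ∀ m → 0 < m → 0ℚ ^ℚ m ≡ 0ℚ
  0^ (suc m) _ = ℚP.*-zeroˡ (0ℚ ^ℚ m)
  vanish : ∀ k → k < n → ℕ→ℚ (n C k) * bernoulli k * 0ℚ ^ℚ (n ∸ k) ≡ 0ℚ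
  vanish k k<n = trans (cong (ℕ→ℚ (n C k) * bernoulli k *_) (0^ (n ∸ k) (ℕP.m<n⇒0<n∸m k<n)))
    (ℚP.*-zeroʳ (ℕ→ℚ (n C k) * bernoulli k))

binomSum-factor : ∀ n x → binomSum n x ≡
  (2ℚ * x + 1ℚ) * (1ℚ + ∑ n (λ k → binom² (suc k) x * invℕ (2 ℕ.* suc k ℕ.+ 1)))
binomSum-factor n x = begin
  binomSum n x                       ≡⟨ ∑-head n (binomSummand x) ⟩
  binomSummand x 0 + ∑ n (binomSummand x ∘ suc)  ≡⟨ cong (binomSummand x 0 +_) (trans (∑-cong n λ k _ → swap (binom² (suc k) x) c (invℕ (2 ℕ.* suc k ℕ.+ 1))) (∑-*ˡ n c g)) ⟩
  1ℚ * (c * 1ℚ) + c * ∑ n g          ≡⟨ collect c (∑ n g) ⟩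
  c * (1ℚ + ∑ n g)                   ∎
  where
  open ≡-Reasoning
  c : ℚ
  c = 2ℚ * x + 1ℚ
  g : ℕ → ℚ
  g k = binom² (suc k) x * invℕ (2 ℕ.* suc k ℕ.+ 1)
  swap : ∀ b c i → b * (c * i) ≡ c * (b * i)
  swap = solve-∀ ℚ-ring
  collect : ∀ c s → 1ℚ * (c * 1ℚ) + c * s ≡ c * (1ℚ + s)
  collect = solve-∀ ℚ-ring

-- Congruences between p-integral rationals

x*↧x≡↥x : ∀ x → x * ℕ→ℚ (↧ₙ x) ≡ ℤ→ℚ (↥ x)
x*↧x≡↥x x@(mkℚ n d-1 _) = begin
  x * ℕ→ℚ (suc d-1)                                ≡⟨ cong (_* ℕ→ℚ (suc d-1)) (ℚP.fromℚᵘ-toℚᵘ x) ⟨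
  fromℚᵘ (toℚᵘ x) * ℕ→ℚ (suc d-1)                  ≡⟨ fromℚᵘ-homo-* (toℚᵘ x) (ℚᵘ.mkℚᵘ (ℤ.+ suc d-1) 0) ⟨
  fromℚᵘ (toℚᵘ x ℚᵘ.* ℚᵘ.mkℚᵘ (ℤ.+ suc d-1) 0)     ≡⟨ ℚP.fromℚᵘ-cong {toℚᵘ x ℚᵘ.* ℚᵘ.mkℚᵘ (ℤ.+ suc d-1) 0} {ℚᵘ.mkℚᵘ n 0} (ℚᵘ.*≡* (trans (ℤP.*-identityʳ _)
                                                        (cong (λ d → n ℤ.* ℤ.+ d) (sym (ℕP.*-identityʳ (suc d-1)))))) ⟩
  ℤ→ℚ n                                            ∎
  where open ≡-Reasoning

-- In lowest terms x = n/e the equation reads n d = i e. As e is coprime to n, it divides d; so one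
-- denominator prime to p suffices for `InZp`.
↧x∣d : ∀ x d i → x * ℕ→ℚ d ≡ ℤ→ℚ i → ↧ₙ x ∣ d
↧x∣d x@(mkℚ n d-1 coprime) d i eq = coprime-divisor (Coprime.sym (Coprime.recompute coprime)) (divides ℤ.∣ i ∣ (begin
  ℤ.∣ n ∣ ℕ.* d                  ≡⟨ ℤP.abs-* n (ℤ.+ d) ⟨
  ℤ.∣ n ℤ.* ℤ.+ d ∣              ≡⟨ cong ℤ.∣_∣ (ℤP.*-identityʳ (n ℤ.* ℤ.+ d)) ⟨
  ℤ.∣ n ℤ.* ℤ.+ d ℤ.* ℤ.+ 1 ∣    ≡⟨ cong ℤ.∣_∣ (ℚᵘP.drop-*≡* nd≃i) ⟩
  ℤ.∣ i ℤ.* ℤ.+ (suc d-1 ℕ.* 1) ∣ ≡⟨ ℤP.abs-* i (ℤ.+ (suc d-1 ℕ.* 1)) ⟩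
  ℤ.∣ i ∣ ℕ.* (suc d-1 ℕ.* 1)    ≡⟨ cong (ℤ.∣ i ∣ ℕ.*_) (ℕP.*-identityʳ (suc d-1)) ⟩
  ℤ.∣ i ∣ ℕ.* suc d-1            ∎))
  where
  open ≡-Reasoning
  nd≃i : ℚᵘ.mkℚᵘ n d-1 ℚᵘ.* ℚᵘ.mkℚᵘ (ℤ.+ d) 0 ℚᵘ.≃ ℚᵘ.mkℚᵘ i 0
  nd≃i = ℚᵘP.≃-trans (ℚᵘP.≃-sym (ℚᵘP.≃-trans (ℚP.toℚᵘ-homo-* x (ℕ→ℚ d))
      (ℚᵘP.*-congˡ {toℚᵘ x} (ℚP.toℚᵘ-fromℚᵘ (ℚᵘ.mkℚᵘ (ℤ.+ d) 0)))))
    (ℚᵘP.≃-trans (ℚᵘP.≃-reflexive (cong toℚᵘ eq)) (ℚP.toℚᵘ-fromℚᵘ (ℚᵘ.mkℚᵘ i 0)))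

module Localisation (p : ℕ) (p-prime : Prime p) where

  P : ℚ
  P = ℕ→ℚ p

  -- Any representation with denominator prime to p is accepted, not only the reduced one. Sums and
  -- products then just multiply denominators, and Euclid's lemma does the rest.
  record ℤₚ (x : ℚ) : Set where
    constructor fraction
    field
      numerator   : ℤ
      denominator : ℕ
      p∤denominator : ¬ p ∣ denominator
      x*denominator : x * ℕ→ℚ denominator ≡ ℤ→ℚ numerator

  InZp⇒ℤₚ : ∀ x → InZp p x → ℤₚ x
  InZp⇒ℤₚ x p∤d = fraction (↥ x) (↧ₙ x) p∤d (x*↧x≡↥x x)

  ℤₚ⇒InZp : ∀ {x} → ℤₚ x → InZp p x
  ℤₚ⇒InZp {x} (fraction i d p∤d eq) p∣↧x = p∤d (∣.∣-trans p∣↧x (↧x∣d x d i eq))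

  p∤m*n : ∀ m n → ¬ p ∣ m → ¬ p ∣ n → ¬ p ∣ m ℕ.* n
  p∤m*n m n p∤m p∤n p∣mn with euclidsLemma m n p-prime p∣mn
  ... | inj₁ p∣m = p∤m p∣m
  ... | inj₂ p∣n = p∤n p∣n

  ℤₚ-ℤ : ∀ i → ℤₚ (ℤ→ℚ i)
  ℤₚ-ℤ i = fraction i 1 p∤1 (ℚP.*-identityʳ (ℤ→ℚ i))
    where
    p∤1 : ¬ p ∣ 1
    p∤1 p∣1 = ¬prime[1] (subst Prime (∣.∣1⇒≡1 p∣1) p-prime)

  ℤₚ-ℕ : ∀ n → ℤₚ (ℕ→ℚ n)
  ℤₚ-ℕ n = ℤₚ-ℤ (ℤ.+ n)

  ℤₚ-0 : ℤₚ 0ℚ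
  ℤₚ-0 = ℤₚ-ℕ 0

  ℤₚ-1 : ℤₚ 1ℚ
  ℤₚ-1 = ℤₚ-ℕ 1

  ℤₚ-+ : ∀ {x y} → ℤₚ x → ℤₚ y → ℤₚ (x + y)
  ℤₚ-+ {x} {y} (fraction i d p∤d eq) (fraction j e p∤e eq′) =
    fraction (i ℤ.* ℤ.+ e ℤ.+ j ℤ.* ℤ.+ d) (d ℕ.* e) (p∤m*n d e p∤d p∤e) (begin
      (x + y) * ℕ→ℚ (d ℕ.* e)                       ≡⟨ cong ((x + y) *_) (ℕ→ℚ-* d e) ⟩
      (x + y) * (ℕ→ℚ d * ℕ→ℚ e)                     ≡⟨ lemma x y (ℕ→ℚ d) (ℕ→ℚ e) ⟩
      x * ℕ→ℚ d * ℕ→ℚ e + y * ℕ→ℚ e * ℕ→ℚ d         ≡⟨ cong₂ (λ u v → u * ℕ→ℚ e + v * ℕ→ℚ d) eq eq′ ⟩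
      ℤ→ℚ i * ℕ→ℚ e + ℤ→ℚ j * ℕ→ℚ d                 ≡⟨ cong₂ _+_ (ℤ→ℚ-* i (ℤ.+ e)) (ℤ→ℚ-* j (ℤ.+ d)) ⟨
      ℤ→ℚ (i ℤ.* ℤ.+ e) + ℤ→ℚ (j ℤ.* ℤ.+ d)         ≡⟨ ℤ→ℚ-+ (i ℤ.* ℤ.+ e) (j ℤ.* ℤ.+ d) ⟨
      ℤ→ℚ (i ℤ.* ℤ.+ e ℤ.+ j ℤ.* ℤ.+ d)             ∎)
    where
    open ≡-Reasoning
    lemma : ∀ x y d e → (x + y) * (d * e) ≡ x * d * e + y * e * d
    lemma = solve-∀ ℚ-ring

  ℤₚ-* : ∀ {x y} → ℤₚ x → ℤₚ y → ℤₚ (x * y)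
  ℤₚ-* {x} {y} (fraction i d p∤d eq) (fraction j e p∤e eq′) =
    fraction (i ℤ.* j) (d ℕ.* e) (p∤m*n d e p∤d p∤e) (begin
      x * y * ℕ→ℚ (d ℕ.* e)           ≡⟨ cong (x * y *_) (ℕ→ℚ-* d e) ⟩
      x * y * (ℕ→ℚ d * ℕ→ℚ e)         ≡⟨ lemma x y (ℕ→ℚ d) (ℕ→ℚ e) ⟩
      x * ℕ→ℚ d * (y * ℕ→ℚ e)         ≡⟨ cong₂ _*_ eq eq′ ⟩
      ℤ→ℚ i * ℤ→ℚ j                   ≡⟨ ℤ→ℚ-* i j ⟨
      ℤ→ℚ (i ℤ.* j)                   ∎)
    where
    open ≡-Reasoning
    lemma : ∀ x y d e → x * y * (d * e) ≡ x * d * (y * e)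
    lemma = solve-∀ ℚ-ring

  ℤₚ-neg : ∀ {x} → ℤₚ x → ℤₚ (- x)
  ℤₚ-neg {x} zx = subst ℤₚ (lemma x) (ℤₚ-* (ℤₚ-ℤ (ℤ.- ℤ.+ 1)) zx)
    where
    lemma : ∀ x → - 1ℚ * x ≡ - x
    lemma = solve-∀ ℚ-ring

  ℤₚ-- : ∀ {x y} → ℤₚ x → ℤₚ y → ℤₚ (x - y)
  ℤₚ-- zx zy = ℤₚ-+ zx (ℤₚ-neg zy)

  ℤₚ-^ : ∀ {x} n → ℤₚ x → ℤₚ (x ^ℚ n)
  ℤₚ-^ zero    zx = ℤₚ-1
  ℤₚ-^ (suc n) zx = ℤₚ-* zx (ℤₚ-^ n zx)

  ℤₚ-∑ : ∀ n {f : ℕ → ℚ} → (∀ k → k < n → ℤₚ (f k)) → ℤₚ (∑ n f)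
  ℤₚ-∑ zero    zf = ℤₚ-0
  ℤₚ-∑ (suc n) zf = ℤₚ-+ (ℤₚ-∑ n λ k k<n → zf k (ℕP.m<n⇒m<1+n k<n)) (zf n (ℕP.n<1+n n))

  ℤₚ-invℕ : ∀ {n} → ¬ p ∣ n → ℤₚ (invℕ n)
  ℤₚ-invℕ {zero}  p∤n = contradiction (p ∣.∣0) p∤n
  ℤₚ-invℕ {suc n} p∤n = fraction (ℤ.+ 1) (suc n) p∤n (trans (ℚP.*-comm (invℕ (suc n)) (ℕ→ℚ (suc n))) (invℕ-inverseʳ n))

  ℤₚ-invℕ-< : ∀ {n} → suc n < p → ℤₚ (invℕ (suc n))
  ℤₚ-invℕ-< n<p = ℤₚ-invℕ (∣.>⇒∤ n<p)

  infix 4 _≈[_]_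
  -- The congruence of the statement with integrality expressed through `ℤₚ`; being a record, it
  -- lets both sides be recovered from the type.
  record _≈[_]_ (x : ℚ) (m : ℕ) (y : ℚ) : Set where
    constructor multiple
    field
      quotient : ℚ
      integral : ℤₚ quotient
      difference : x - y ≡ (P ^ℚ m) * quotient

  ≈⇒mod : ∀ {x y m} → x ≈[ m ] y → x ≡ y [mod p ^ m ]
  ≈⇒mod (multiple z zz eq) = z , ℤₚ⇒InZp zz , eq

  ≈-reflexive : ∀ {m x y} → x ≡ y → x ≈[ m ] y
  ≈-reflexive {m} {x} refl = multiple 0ℚ ℤₚ-0 (trans (ℚP.+-inverseʳ x) (sym (ℚP.*-zeroʳ (P ^ℚ m))))

  ≈-refl : ∀ {m x} → x ≈[ m ] x
  ≈-refl = ≈-reflexive refl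

  ≈-+ : ∀ {m x y x′ y′} → x ≈[ m ] x′ → y ≈[ m ] y′ → x + y ≈[ m ] x′ + y′
  ≈-+ {m} {x} {y} {x′} {y′} (multiple z zz eq) (multiple w zw eq′) = multiple (z + w) (ℤₚ-+ zz zw)
    (trans (lemma x y x′ y′) (trans (cong₂ _+_ eq eq′) (sym (ℚP.*-distribˡ-+ (P ^ℚ m) z w))))
    where
    lemma : ∀ x y x′ y′ → x + y - (x′ + y′) ≡ x - x′ + (y - y′)
    lemma = solve-∀ ℚ-ring

  ≈-*ˡ : ∀ {m c x y} → ℤₚ c → x ≈[ m ] y → c * x ≈[ m ] c * y
  ≈-*ˡ {m} {c} {x} {y} zc (multiple z zz eq) = multiple (c * z) (ℤₚ-* zc zz)
    (trans (lemma₁ c x y) (trans (cong (c *_) eq) (lemma₂ c (P ^ℚ m) z)))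
    where
    lemma₁ : ∀ c x y → c * x - c * y ≡ c * (x - y)
    lemma₁ = solve-∀ ℚ-ring
    lemma₂ : ∀ c q z → c * (q * z) ≡ q * (c * z)
    lemma₂ = solve-∀ ℚ-ring

  ≈-*ʳ : ∀ {m c x y} → ℤₚ c → x ≈[ m ] y → x * c ≈[ m ] y * c
  ≈-*ʳ {m} {c} {x} {y} zc x≈y = subst₂ _≈[ m ]_ (ℚP.*-comm c x) (ℚP.*-comm c y) (≈-*ˡ zc x≈y)

  ≈-neg : ∀ {m x y} → x ≈[ m ] y → - x ≈[ m ] - y
  ≈-neg {m} {x} {y} x≈y = subst₂ _≈[ m ]_ (lemma x) (lemma y) (≈-*ˡ (ℤₚ-ℤ (ℤ.- ℤ.+ 1)) x≈y)
    where
    lemma : ∀ x → - 1ℚ * x ≡ - x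
    lemma = solve-∀ ℚ-ring

  ≈-- : ∀ {m x y x′ y′} → x ≈[ m ] x′ → y ≈[ m ] y′ → x - y ≈[ m ] x′ - y′
  ≈-- x≈x′ y≈y′ = ≈-+ x≈x′ (≈-neg y≈y′)

  ≈-sym : ∀ {m x y} → x ≈[ m ] y → y ≈[ m ] x
  ≈-sym {m} {x} {y} (multiple z zz eq) = multiple (- z) (ℤₚ-neg zz)
    (trans (lemma₁ x y) (trans (cong -_ eq) (lemma₂ (P ^ℚ m) z)))
    where
    lemma₁ : ∀ x y → y - x ≡ - (x - y)
    lemma₁ = solve-∀ ℚ-ring
    lemma₂ : ∀ q z → - (q * z) ≡ q * - z
    lemma₂ = solve-∀ ℚ-ring

  ≈-trans : ∀ {m x y z} → x ≈[ m ] y → y ≈[ m ] z → x ≈[ m ] z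
  ≈-trans {m} {x} {y} {z} (multiple u zu eq) (multiple v zv eq′) = multiple (u + v) (ℤₚ-+ zu zv)
    (trans (lemma x y z) (trans (cong₂ _+_ eq eq′) (sym (ℚP.*-distribˡ-+ (P ^ℚ m) u v))))
    where
    lemma : ∀ x y z → x - z ≡ x - y + (y - z)
    lemma = solve-∀ ℚ-ring

  ≈-setoid : ℕ → Setoid 0ℓ 0ℓ
  ≈-setoid m = record
    { Carrier = ℚ
    ; _≈_ = _≈[ m ]_
    ; isEquivalence = record { refl = ≈-refl ; sym = ≈-sym ; trans = ≈-trans }
    }

  -- From xy - x′y′ = x(y - y′) + (x - x′)y′, whence the two integrality assumptions.
  ≈-* : ∀ {m x y x′ y′} → ℤₚ x → ℤₚ y′ → x ≈[ m ] x′ → y ≈[ m ] y′ → x * y ≈[ m ] x′ * y′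
  ≈-* zx zy′ x≈x′ y≈y′ = ≈-trans (≈-*ˡ zx y≈y′) (≈-*ʳ zy′ x≈x′)

  ≈-^ : ∀ {m x y} n → ℤₚ x → ℤₚ y → x ≈[ m ] y → x ^ℚ n ≈[ m ] y ^ℚ n
  ≈-^ zero    zx zy x≈y = ≈-refl
  ≈-^ (suc n) zx zy x≈y = ≈-* zx (ℤₚ-^ n zy) x≈y (≈-^ n zx zy x≈y)

  ≈-∑ : ∀ {m} n {f g : ℕ → ℚ} → (∀ k → k < n → f k ≈[ m ] g k) → ∑ n f ≈[ m ] ∑ n g
  ≈-∑ zero    f≈g = ≈-refl
  ≈-∑ (suc n) f≈g = ≈-+ (≈-∑ n λ k k<n → f≈g k (ℕP.m<n⇒m<1+n k<n)) (f≈g n (ℕP.n<1+n n))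

  -- The source of all precision: a quantity multiplied by p needs to be known to one power of p
  -- less.
  ≈-P* : ∀ {m x y} → x ≈[ m ] y → P * x ≈[ suc m ] P * y
  ≈-P* {m} {x} {y} (multiple z zz eq) = multiple z zz
    (trans (lemma P x y) (trans (cong (P *_) eq) (sym (ℚP.*-assoc P (P ^ℚ m) z))))
    where
    lemma : ∀ c x y → c * x - c * y ≡ c * (x - y)
    lemma = solve-∀ ℚ-ring

  ≈[0] : ∀ {x y} → ℤₚ x → ℤₚ y → x ≈[ 0 ] y
  ≈[0] {x} {y} zx zy = multiple (x - y) (ℤₚ-- zx zy) (sym (ℚP.*-identityˡ (x - y)))

  P*≈0 : ∀ {m x} → x ≈[ m ] 0ℚ → P * x ≈[ suc m ] 0ℚ
  P*≈0 {m} {x} x≈0 = subst (P * x ≈[ suc m ]_) (ℚP.*-zeroʳ P) (≈-P* x≈0)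

  P*≈[1]0 : ∀ {x} → ℤₚ x → P * x ≈[ 1 ] 0ℚ
  P*≈[1]0 zx = P*≈0 (≈[0] zx ℤₚ-0)

  ≈0-cancelˡ : ∀ {m c x} d → ℤₚ d → d * c ≡ 1ℚ → c * x ≈[ m ] 0ℚ → x ≈[ m ] 0ℚ
  ≈0-cancelˡ {m} {c} {x} d zd dc≡1 cx≈0 = subst₂ _≈[ m ]_
    (trans (sym (ℚP.*-assoc d c x)) (trans (cong (_* x) dc≡1) (ℚP.*-identityˡ x))) (ℚP.*-zeroʳ d) (≈-*ˡ zd cx≈0)

  x+y≈0⇒x≈-y : ∀ {m x y} → x + y ≈[ m ] 0ℚ → x ≈[ m ] - y
  x+y≈0⇒x≈-y {m} {x} {y} x+y≈0 = subst₂ _≈[ m ]_ (lemma x y) (ℚP.+-identityˡ (- y)) (≈-- x+y≈0 (≈-refl {x = y}))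
    where
    lemma : ∀ x y → x + y - y ≡ x
    lemma = solve-∀ ℚ-ring

  ≈-weaken : ∀ {m x y} → x ≈[ suc m ] y → x ≈[ m ] y
  ≈-weaken {m} (multiple z zz eq) = multiple (P * z) (ℤₚ-* (ℤₚ-ℕ p) zz) (trans eq (lemma P (P ^ℚ m) z))
    where
    lemma : ∀ c q z → c * q * z ≡ q * (c * z)
    lemma = solve-∀ ℚ-ring

module OddPrime (m : ℕ) (p-prime : Prime (suc (2 ℕ.* suc m))) where

  -- With p built from m, the facts n ≥ 1, p - 1 = 2n and p = (p - 2) + 2 hold by computation.
  n N p : ℕ
  n = suc m
  N = 2 ℕ.* n
  p = suc N

  open Localisation p p-prime public

  -- Harmonic numbers and the Fermat quotient modulo p

  ℤₚ-1/ : ∀ {k} → k < N → ℤₚ (invℕ (suc k))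
  ℤₚ-1/ k<N = ℤₚ-invℕ-< (s≤s k<N)

  ℤₚ-H : ∀ r → r ≤ N → ℤₚ (H r)
  ℤₚ-H r r≤N = ℤₚ-∑ r λ k k<r → ℤₚ-1/ (ℕP.<-≤-trans k<r r≤N)

  -- Two numbers with sum p have reciprocals with sum p divided by their product.
  invℕ-reflect : ∀ {a b} → suc a ℕ.+ suc b ≡ p → invℕ (suc a) ≈[ 1 ] - invℕ (suc b)
  invℕ-reflect {a} {b} a+b≡p = x+y≈0⇒x≈-y (≈-trans (≈-reflexive i+j≡P*) (P*≈[1]0 (ℤₚ-* (ℤₚ-1/ a<N) (ℤₚ-1/ b<N))))
    where
    open ≡-Reasoning
    a+1+b≡N : a ℕ.+ suc b ≡ N
    a+1+b≡N = ℕP.suc-injective a+b≡p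
    a<N : a < N
    a<N = subst (a <_) a+1+b≡N (ℕP.m<m+n a (s≤s z≤n))
    b<N : b < N
    b<N = subst (b <_) a+1+b≡N (ℕP.m≤n+m (suc b) a)
    i j : ℚ
    i = invℕ (suc a)
    j = invℕ (suc b)
    lemma : ∀ α β i j → (α + β) * (i * j) ≡ β * j * i + α * i * j
    lemma = solve-∀ ℚ-ring
    i+j≡P* : i + j ≡ P * (i * j)
    i+j≡P* = begin
      i + j                     ≡⟨ cong₂ _+_ (ℚP.*-identityˡ i) (ℚP.*-identityˡ j) ⟨
      1ℚ * i + 1ℚ * j           ≡⟨ cong₂ (λ u v → u * i + v * j) (invℕ-inverseʳ b) (invℕ-inverseʳ a) ⟨
      ℕ→ℚ (suc b) * j * i + ℕ→ℚ (suc a) * i * j ≡⟨ lemma (ℕ→ℚ (suc a)) (ℕ→ℚ (suc b)) i j ⟨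
      (ℕ→ℚ (suc a) + ℕ→ℚ (suc b)) * (i * j)     ≡⟨ cong (_* (i * j)) (ℕ→ℚ-+ (suc a) (suc b)) ⟨
      ℕ→ℚ (suc a ℕ.+ suc b) * (i * j)           ≡⟨ cong (λ k → ℕ→ℚ k * (i * j)) a+b≡p ⟩
      P * (i * j)                               ∎

  ℤₚ-½ : ℤₚ (invℕ 2)
  ℤₚ-½ = ℤₚ-1/ (s≤s (ℕP.≤-trans (s≤s z≤n) (ℕP.m≤n+m (n ℕ.+ 0) m)))

  -- Reversing the sum under k ↦ p - k turns H_{p-1} into its negative modulo p, and 2 is
  -- invertible.
  H[N]≈0 : H N ≈[ 1 ] 0ℚ
  H[N]≈0 = ≈0-cancelˡ (invℕ 2) ℤₚ-½ refl (≈-trans (≈-reflexive (double (H N)))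
    (≈-trans (≈-- (≈-refl {x = H N}) -H≈H) (≈-reflexive (ℚP.+-inverseʳ (H N)))))
    where
    double : ∀ h → 2ℚ * h ≡ h - - h
    double = solve-∀ ℚ-ring
    open SetoidReasoning (≈-setoid 1)
    -H≈H : - H N ≈[ 1 ] H N
    -H≈H = begin
      - H N                              ≡⟨ ∑-neg N (λ k → invℕ (suc k)) ⟨
      ∑ N (λ k → - invℕ (suc k))         ≈⟨ ≈-∑ N (λ k k<N → ≈-sym (invℕ-reflect (cong suc (ℕP.m∸n+n≡m k<N)))) ⟩
      ∑ N (λ k → invℕ (suc (N ∸ suc k))) ≡⟨ ∑-reverse N (λ k → invℕ (suc k)) ⟨
      H N                                ∎

  -- Starting from H_{p-1} ≡ 0, one term at a time moves across by `invℕ-reflect`. It is needed for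
  -- r > n, where the reflected sum yields H_{p-1-r} in place of H_r.
  H-reflect : ∀ r r′ → r ℕ.+ r′ ≡ N → H r′ ≈[ 1 ] H r
  H-reflect zero    r′ refl = H[N]≈0
  H-reflect (suc r) r′ eq   = begin
    H r′                                     ≡⟨ lemma (H r′) (invℕ (suc r′)) ⟨
    H (suc r′) - invℕ (suc r′)               ≈⟨ ≈-- (H-reflect r (suc r′) r+1+r′≡N) (invℕ-reflect (cong suc (trans (ℕP.+-comm r′ (suc r)) eq))) ⟩
    H r - - invℕ (suc r)                     ≡⟨ double-neg (H r) (invℕ (suc r)) ⟩
    H (suc r)                                ∎
    where
    open SetoidReasoning (≈-setoid 1)
    r+1+r′≡N : r ℕ.+ suc r′ ≡ N
    r+1+r′≡N = trans (ℕP.+-suc r r′) eq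
    double-neg : ∀ h i → h - - i ≡ h + i
    double-neg = solve-∀ ℚ-ring
    lemma : ∀ h i → h + i - i ≡ h
    lemma = solve-∀ ℚ-ring

  -- By Pascal's rule neighbouring coefficients C(p-1,k) and C(p-1,k+1) add up to C(p,k+1), a
  -- multiple of p.
  NCk≈[-1]^k : ∀ k → k ≤ N → ℕ→ℚ (N C k) ≈[ 1 ] (- 1ℚ) ^ℚ k
  NCk≈[-1]^k zero    _   = ≈-refl
  NCk≈[-1]^k (suc k) k<N = begin
    ℕ→ℚ (N C suc k)          ≈⟨ x+y≈0⇒x≈-y sum≈0 ⟩
    - ℕ→ℚ (N C k)            ≈⟨ ≈-neg (NCk≈[-1]^k k (ℕP.<⇒≤ k<N)) ⟩
    - ((- 1ℚ) ^ℚ k)          ≡⟨ lemma ((- 1ℚ) ^ℚ k) ⟩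
    (- 1ℚ) ^ℚ suc k          ∎
    where
    open SetoidReasoning (≈-setoid 1)
    lemma : ∀ y → - y ≡ - 1ℚ * y
    lemma = solve-∀ ℚ-ring
    sum≈0 : ℕ→ℚ (N C suc k) + ℕ→ℚ (N C k) ≈[ 1 ] 0ℚ
    sum≈0 = begin
      ℕ→ℚ (N C suc k) + ℕ→ℚ (N C k) ≡⟨ ℚP.+-comm (ℕ→ℚ (N C suc k)) (ℕ→ℚ (N C k)) ⟩
      ℕ→ℚ (N C k) + ℕ→ℚ (N C suc k) ≡⟨ ℕ→ℚ-+ (N C k) (N C suc k) ⟨
      ℕ→ℚ ((N C k) ℕ.+ (N C suc k)) ≡⟨ cong ℕ→ℚ (nCk+nC[k+1]≡[n+1]C[k+1] N k) ⟩
      ℕ→ℚ (p C suc k)               ≡⟨ [n+1]C[k+1]≡[n+1]*nCk/[k+1] (ℕP.<⇒≤ k<N) ⟩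
      P * (ℕ→ℚ (N C k) * invℕ (suc k)) ≈⟨ P*≈[1]0 (ℤₚ-* (ℤₚ-ℕ (N C k)) (ℤₚ-1/ k<N)) ⟩
      0ℚ                            ∎

  2*fermatQuot2≈ : 2ℚ * fermatQuot2 p ≈[ 1 ] - H n
  2*fermatQuot2≈ = begin
    2ℚ * fermatQuot2 p                          ≡⟨ 2*fermatQuot2 N ⟩
    ∑ N (λ k → ℕ→ℚ (N C k) * invℕ (suc k))      ≈⟨ ≈-∑ N (λ k k<N → ≈-*ʳ (ℤₚ-1/ k<N) (NCk≈[-1]^k k (ℕP.<⇒≤ k<N))) ⟩
    ∑ N (λ k → (- 1ℚ) ^ℚ k * invℕ (suc k))      ≡⟨ ∑-alternating-invℕ n ⟩
    H N - H n                                   ≈⟨ ≈-- H[N]≈0 ≈-refl ⟩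
    0ℚ - H n                                    ≡⟨ ℚP.+-identityˡ (- H n) ⟩
    - H n                                       ∎
    where open SetoidReasoning (≈-setoid 1)

  -- Fermat's little theorem and Bernoulli polynomials modulo p

  frobenius : ∀ {x} → ℤₚ x → (x + 1ℚ) ^ℚ p ≈[ 1 ] x ^ℚ p + 1ℚ
  frobenius {x} zx = begin
    (x + 1ℚ) ^ℚ p              ≡⟨ binomial-theorem-inner N x ⟩
    1ℚ + P * s + x ^ℚ p        ≈⟨ ≈-+ (≈-+ (≈-refl {x = 1ℚ}) (P*≈[1]0 zs)) (≈-refl {x = x ^ℚ p}) ⟩
    1ℚ + 0ℚ + x ^ℚ p           ≡⟨ ℚP.+-comm 1ℚ (x ^ℚ p) ⟩
    x ^ℚ p + 1ℚ                ∎
    where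
    open SetoidReasoning (≈-setoid 1)
    s : ℚ
    s = ∑ N (λ k → ℕ→ℚ (N C k) * invℕ (suc k) * x ^ℚ suc k)
    zs : ℤₚ s
    zs = ℤₚ-∑ N λ k k<N → ℤₚ-* (ℤₚ-* (ℤₚ-ℕ (N C k)) (ℤₚ-1/ k<N)) (ℤₚ-^ (suc k) zx)

  -- Stated at -j because the Bernoulli polynomial is evaluated at -a; the induction descends by
  -- applying `frobenius` at -(j + 1).
  fermat-negative : ∀ j → (- ℕ→ℚ j) ^ℚ p ≈[ 1 ] - ℕ→ℚ j
  fermat-negative zero    = ≈-reflexive (ℚP.*-zeroˡ (0ℚ ^ℚ N))
  fermat-negative (suc j) = begin
    x ^ℚ p                    ≡⟨ add-sub (x ^ℚ p) ⟩
    x ^ℚ p + 1ℚ - 1ℚ          ≈⟨ ≈-- (≈-sym (frobenius (ℤₚ-neg (ℤₚ-ℕ (suc j))))) (≈-refl {x = 1ℚ}) ⟩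
    (x + 1ℚ) ^ℚ p - 1ℚ        ≡⟨ cong (λ y → y ^ℚ p - 1ℚ) (-ℕ→ℚ-suc j) ⟩
    (- ℕ→ℚ j) ^ℚ p - 1ℚ       ≈⟨ ≈-- (fermat-negative j) (≈-refl {x = 1ℚ}) ⟩
    - ℕ→ℚ j - 1ℚ              ≡⟨ neg-+ (ℕ→ℚ j) ⟩
    - (ℕ→ℚ j + 1ℚ)            ≡⟨ cong -_ (ℕ→ℚ-suc j) ⟨
    x                         ∎
    where
    open SetoidReasoning (≈-setoid 1)
    x : ℚ
    x = - ℕ→ℚ (suc j)
    add-sub : ∀ y → y ≡ y + 1ℚ - 1ℚ
    add-sub = solve-∀ ℚ-ring
    neg-+ : ∀ y → - y - 1ℚ ≡ - (y + 1ℚ)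
    neg-+ = solve-∀ ℚ-ring

  [-j]^[p-2] : ∀ {j} → j < N → (- ℕ→ℚ (suc j)) ^ℚ (N ∸ 1) ≈[ 1 ] - invℕ (suc j)
  [-j]^[p-2] {j} j<N = begin
    y                              ≡⟨ unit₂ y ⟨
    1ℚ * 1ℚ * y                    ≡⟨ cong (λ e → e * e * y) (invℕ-inverseʳ j) ⟨
    κ * i * (κ * i) * y            ≡⟨ regroup κ i y ⟨
    -- The inner product is (-κ)^p by computation, the exponent of `y` being p - 2.
    i * i * ((- κ) * ((- κ) * y))  ≈⟨ ≈-*ˡ (ℤₚ-* (ℤₚ-1/ j<N) (ℤₚ-1/ j<N)) (fermat-negative (suc j)) ⟩
    i * i * (- κ)                  ≡⟨ pull κ i ⟩
    - (κ * i * i)                  ≡⟨ cong (λ e → - (e * i)) (invℕ-inverseʳ j) ⟩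
    - (1ℚ * i)                     ≡⟨ cong -_ (ℚP.*-identityˡ i) ⟩
    - i                            ∎
    where
    open SetoidReasoning (≈-setoid 1)
    y κ i : ℚ
    y = (- ℕ→ℚ (suc j)) ^ℚ (N ∸ 1)
    κ = ℕ→ℚ (suc j)
    i = invℕ (suc j)
    unit₂ : ∀ y → 1ℚ * 1ℚ * y ≡ y
    unit₂ = solve-∀ ℚ-ring
    regroup : ∀ κ i y → i * i * ((- κ) * ((- κ) * y)) ≡ κ * i * (κ * i) * y
    regroup = solve-∀ ℚ-ring
    pull : ∀ κ i → i * i * (- κ) ≡ - (κ * i * i)
    pull = solve-∀ ℚ-ring

  -- The recurrence for B_k divides by k + 1, which stays below p as long as k < p - 1. The list of
  -- earlier values calls for strong induction, carried by the bound l.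
  ℤₚ-bernoulli : ∀ l → l ≤ N → ∀ k → k < l → ℤₚ (bernoulli k)
  ℤₚ-bernoulli (suc l) l<N k k<1+l with ℕP.m≤n⇒m<n∨m≡n (ℕP.≤-pred k<1+l)
  ... | inj₁ k<l = ℤₚ-bernoulli l (ℕP.<⇒≤ l<N) k k<l
  ℤₚ-bernoulli (suc zero)    l<N .zero    _ | inj₂ refl = ℤₚ-1
  ℤₚ-bernoulli (suc (suc l)) l<N .(suc l) _ | inj₂ refl = subst ℤₚ (sym (bernoulli-suc l))
    (ℤₚ-neg (ℤₚ-* (ℤₚ-1/ l<N) (ℤₚ-∑ (suc l) λ k k<l →
      ℤₚ-* (ℤₚ-ℕ (suc (suc l) C k)) (ℤₚ-bernoulli (suc l) (ℕP.<⇒≤ l<N) k k<l))))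

  -- Subtracting B_{p-1} leaves only coefficients B_k with k < p - 1, all p-integral; this is why
  -- `Δ` respects congruences modulo p.
  Δ : ℚ → ℚ
  Δ x = bernoulliPoly N x - bernoulli N

  Δ-cong : ∀ {x y} → ℤₚ x → ℤₚ y → x ≈[ 1 ] y → Δ x ≈[ 1 ] Δ y
  Δ-cong {x} {y} zx zy x≈y = subst₂ _≈[ 1 ]_ (sym (bernoulliPoly-bernoulli N x)) (sym (bernoulliPoly-bernoulli N y))
    (≈-∑ N λ k k<N → ≈-*ˡ (ℤₚ-* (ℤₚ-ℕ (N C k)) (ℤₚ-bernoulli N ℕP.≤-refl k k<N)) (≈-^ (N ∸ k) zx zy x≈y))

  N≈-1 : ℕ→ℚ N ≈[ 1 ] - 1ℚ
  N≈-1 = x+y≈0⇒x≈-y (subst₂ _≈[ 1 ]_ (trans (ℚP.*-identityʳ P) (ℕ→ℚ-suc N)) refl (P*≈[1]0 ℤₚ-1))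

  -- The step from -j to -(j+1) subtracts (p-1)(-(j+1))^{p-2}, and this is (-1)(-1/(j+1)) = 1/(j+1)
  -- modulo p.
  Δ≈-H : ∀ j → j ≤ N → Δ (- ℕ→ℚ j) ≈[ 1 ] - H j
  Δ≈-H zero    _   = ≈-reflexive (bernoulliPoly-0 N)
  Δ≈-H (suc j) j<N = begin
    Δ x                            ≡⟨ lemma₁ (bernoulliPoly N x) (bernoulli N) (ℕ→ℚ N * y) ⟩
    bernoulliPoly N x + ℕ→ℚ N * y - bernoulli N - ℕ→ℚ N * y
                                   ≡⟨ cong (λ b → b - bernoulli N - ℕ→ℚ N * y) (bernoulliPoly-difference (N ∸ 1) x) ⟨
    Δ (x + 1ℚ) - ℕ→ℚ N * y         ≡⟨ cong (λ z → Δ z - ℕ→ℚ N * y) (-ℕ→ℚ-suc j) ⟩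
    Δ (- ℕ→ℚ j) - ℕ→ℚ N * y        ≈⟨ ≈-- (Δ≈-H j (ℕP.<⇒≤ j<N)) (≈-* (ℤₚ-ℕ N) (ℤₚ-neg (ℤₚ-1/ j<N)) N≈-1 ([-j]^[p-2] j<N)) ⟩
    - H j - - 1ℚ * - i             ≡⟨ lemma₂ (H j) i ⟩
    - (H j + i)                    ∎
    where
    open SetoidReasoning (≈-setoid 1)
    x y i : ℚ
    x = - ℕ→ℚ (suc j)
    y = x ^ℚ (N ∸ 1)
    i = invℕ (suc j)
    lemma₁ : ∀ a b c → a - b ≡ a + c - b - c
    lemma₁ = solve-∀ ℚ-ring
    lemma₂ : ∀ h i → - h - - 1ℚ * - i ≡ - (h + i)
    lemma₂ = solve-∀ ℚ-ring

  -- The product and the sum modulo p²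

  P*P*≈0 : ∀ {z} → ℤₚ z → P * (P * z) ≈[ 2 ] 0ℚ
  P*P*≈0 zz = P*≈0 (P*≈[1]0 zz)

  P≡2n+1 : P ≡ 2ℚ * ℕ→ℚ n + 1ℚ
  P≡2n+1 = trans (cong ℕ→ℚ (ℕP.+-comm 1 N)) (ℕ→ℚ-odd n)

  ℤₚ-binom² : ∀ k {x} → k ≤ N → ℤₚ x → ℤₚ (binom² k x)
  ℤₚ-binom² zero        _   zx = ℤₚ-1
  ℤₚ-binom² (suc k) {x} k<N zx = subst ℤₚ (sym (binom²-suc k x)) (ℤₚ-* (ℤₚ-binom² k (ℕP.<⇒≤ k<N) zx)
    (ℤₚ-* (ℤₚ-* (ℤₚ-- zx (ℤₚ-ℕ k)) (ℤₚ-- (ℤₚ-- (ℤₚ-neg ℤₚ-1) zx) (ℤₚ-ℕ k))) (ℤₚ-* (ℤₚ-1/ k<N) (ℤₚ-1/ k<N))))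

  ℤₚ-∏ : ∀ k {x} → k ≤ N → ℤₚ x → ℤₚ (∏ k x)
  ℤₚ-∏ zero    _   zx = ℤₚ-1
  ℤₚ-∏ (suc k) k<N zx = ℤₚ-* (ℤₚ-∏ k (ℕP.<⇒≤ k<N) zx)
    (ℤₚ-- ℤₚ-1 (ℤₚ-* (ℤₚ-* zx zx) (ℤₚ-* (ℤₚ-1/ k<N) (ℤₚ-1/ k<N))))

  n≤N : n ≤ N
  n≤N = ℕP.m≤m+n n (n ℕ.+ 0)

  -- The factor p clears the only weight that is not p-integral, 1/(2n+1) = 1/p.
  γ : ℕ → ℚ
  γ k = P * invℕ (2 ℕ.* suc k ℕ.+ 1)

  ℤₚ-invℕ-odd : ∀ {k} → k < m → ℤₚ (invℕ (2 ℕ.* suc k ℕ.+ 1))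
  ℤₚ-invℕ-odd {k} k<m = subst (ℤₚ ∘ invℕ) (ℕP.+-comm 1 (2 ℕ.* suc k)) (ℤₚ-1/ (ℕP.*-monoʳ-< 2 (s≤s k<m)))

  γ[m]≡1 : γ m ≡ 1ℚ
  γ[m]≡1 = trans (cong (λ l → P * invℕ l) (ℕP.+-comm N 1)) (invℕ-inverseʳ N)

  ℤₚ-γ : ∀ {k} → k < n → ℤₚ (γ k)
  ℤₚ-γ k<n with ℕP.m≤n⇒m<n∨m≡n (ℕP.≤-pred k<n)
  ... | inj₁ k<m  = ℤₚ-* (ℤₚ-ℕ p) (ℤₚ-invℕ-odd k<m)
  ... | inj₂ refl = subst ℤₚ (sym γ[m]≡1) ℤₚ-1

  -- Because 2n = p - 1 ≡ -1.
  1/n≈-2 : invℕ n ≈[ 1 ] - 2ℚ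
  1/n≈-2 = x+y≈0⇒x≈-y (≈-trans (≈-reflexive i+2≡P*i) (P*≈[1]0 (ℤₚ-1/ n≤N)))
    where
    open ≡-Reasoning
    i : ℚ
    i = invℕ n
    lemma : ∀ ν i → i + 2ℚ * (ν * i) ≡ (2ℚ * ν + 1ℚ) * i
    lemma = solve-∀ ℚ-ring
    i+2≡P*i : i + 2ℚ ≡ P * i
    i+2≡P*i = begin
      i + 2ℚ                      ≡⟨ cong (λ e → i + 2ℚ * e) (invℕ-inverseʳ m) ⟨
      i + 2ℚ * (ℕ→ℚ n * i)        ≡⟨ lemma (ℕ→ℚ n) i ⟩
      (2ℚ * ℕ→ℚ n + 1ℚ) * i       ≡⟨ cong (_* i) P≡2n+1 ⟨
      P * i                       ∎

  -- Every `γ` but the last is divisible by p; the last is 1 and meets 1/n² ≡ (-2)² = 4.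
  ∑γ/k²≈4 : ∑ n (λ k → γ k * (invℕ (suc k) * invℕ (suc k))) ≈[ 1 ] 4ℚ
  ∑γ/k²≈4 = begin
    ∑ m f + γ m * (invℕ n * invℕ n)   ≈⟨ ≈-+ (≈-∑ m f≈0) (≈-*ˡ (ℤₚ-γ ℕP.≤-refl) (≈-* (ℤₚ-1/ n≤N) (ℤₚ-neg (ℤₚ-ℕ 2)) 1/n≈-2 1/n≈-2)) ⟩
    ∑ m (λ _ → 0ℚ) + γ m * (- 2ℚ * - 2ℚ) ≡⟨ cong₂ (λ s g → s + g * (- 2ℚ * - 2ℚ)) (∑-0 m) γ[m]≡1 ⟩
    4ℚ                 ∎
    where
    open SetoidReasoning (≈-setoid 1)
    f : ℕ → ℚ
    f k = γ k * (invℕ (suc k) * invℕ (suc k))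
    f≈0 : ∀ k → k < m → f k ≈[ 1 ] 0ℚ
    f≈0 k k<m = ≈-trans (≈-reflexive (ℚP.*-assoc P (invℕ (2 ℕ.* suc k ℕ.+ 1)) (invℕ (suc k) * invℕ (suc k))))
      (P*≈[1]0 (ℤₚ-* (ℤₚ-invℕ-odd k<m) (ℤₚ-* (ℤₚ-1/ k<N) (ℤₚ-1/ k<N))))
      where
      k<N : k < N
      k<N = ℕP.<-≤-trans k<m (ℕP.≤-trans (ℕP.n≤1+n m) n≤N)

  module _ (t : ℚ) (zt : ℤₚ t) where

    ℤₚ-Pt+ : ∀ j → ℤₚ (P * t + ℕ→ℚ j)
    ℤₚ-Pt+ j = ℤₚ-+ (ℤₚ-* (ℤₚ-ℕ p) zt) (ℤₚ-ℕ j)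

    Pt+suc : ∀ j → P * t + ℕ→ℚ (suc j) ≡ P * t + ℕ→ℚ j + 1ℚ
    Pt+suc j = trans (cong (P * t +_) (ℕ→ℚ-suc j)) (sym (ℚP.+-assoc (P * t) (ℕ→ℚ j) 1ℚ))

    -- The argument enters only through its square, here p²t². All partial products are needed,
    -- since `binom²-∏` brings in `∏ k` for each k.
    ∏[Pt]≈1 : ∀ k → k ≤ N → ∏ k (P * t) ≈[ 2 ] 1ℚ
    ∏[Pt]≈1 zero    _   = ≈-refl
    ∏[Pt]≈1 (suc k) k<N = ≈-* (ℤₚ-∏ k (ℕP.<⇒≤ k<N) (ℤₚ-* (ℤₚ-ℕ p) zt)) (ℤₚ-- ℤₚ-1 ℤₚ-0) (∏[Pt]≈1 k (ℕP.<⇒≤ k<N))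
      (≈-- (≈-refl {x = 1ℚ}) (≈-trans (≈-reflexive (lemma P t (i * i))) (P*P*≈0 (ℤₚ-* (ℤₚ-* zt zt) (ℤₚ-* zi zi)))))
      where
      i : ℚ
      i = invℕ (suc k)
      zi : ℤₚ i
      zi = ℤₚ-1/ k<N
      lemma : ∀ q t j → q * t * (q * t) * j ≡ q * (q * (t * t * j))
      lemma = solve-∀ ℚ-ring

    -- The increment is p·b with b = `binom² n y`, so b ≡ 0 modulo p is required. The induction
    -- hypothesis supplies this too: (y - n) b = y `∏ n y` ≡ pt ≡ 0, while y - n ≡ -(n - j) is a
    -- unit.
    [Pt+j]*∏≈Pt : ∀ j → j ≤ n → (P * t + ℕ→ℚ j) * ∏ n (P * t + ℕ→ℚ j) ≈[ 2 ] P * t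
    [Pt+j]*∏≈Pt zero    _   = begin
      (P * t + 0ℚ) * ∏ n (P * t + 0ℚ) ≡⟨ cong (λ y → y * ∏ n y) (ℚP.+-identityʳ (P * t)) ⟩
      P * t * ∏ n (P * t)             ≈⟨ ≈-*ˡ (ℤₚ-* (ℤₚ-ℕ p) zt) (∏[Pt]≈1 n n≤N) ⟩
      P * t * 1ℚ                      ≡⟨ ℚP.*-identityʳ (P * t) ⟩
      P * t                           ∎
      where open SetoidReasoning (≈-setoid 2)
    [Pt+j]*∏≈Pt (suc j) j<n = begin
      (P * t + ℕ→ℚ (suc j)) * ∏ n (P * t + ℕ→ℚ (suc j)) ≡⟨ cong (λ z → z * ∏ n z) (Pt+suc j) ⟩
      (y + 1ℚ) * ∏ n (y + 1ℚ)                           ≡⟨ [x+1]*∏-step n y ⟩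
      y * ∏ n y + (2ℚ * ℕ→ℚ n + 1ℚ) * b                 ≡⟨ cong (λ q → y * ∏ n y + q * b) P≡2n+1 ⟨
      y * ∏ n y + P * b                                 ≈⟨ ≈-+ IH (P*≈0 b≈0) ⟩
      P * t + 0ℚ                                        ≡⟨ ℚP.+-identityʳ (P * t) ⟩
      P * t                                             ∎
      where
      y b δ : ℚ
      y = P * t + ℕ→ℚ j
      b = binom² n y
      -- This is n - j, written as a successor so that its reciprocal is available; it is nonzero
      -- since j < n.
      δ = ℕ→ℚ (suc (n ∸ suc j))
      zb : ℤₚ b
      zb = ℤₚ-binom² n n≤N (ℤₚ-Pt+ j)
      IH : y * ∏ n y ≈[ 2 ] P * t
      IH = [Pt+j]*∏≈Pt j (ℕP.<⇒≤ j<n)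
      lemma : ∀ q t ι δ b → δ * b ≡ q * (t * b) - (q * t + ι - (δ + ι)) * b
      lemma = solve-∀ ℚ-ring
      δ+j≡n : δ + ℕ→ℚ j ≡ ℕ→ℚ n
      δ+j≡n = trans (sym (ℕ→ℚ-+ (suc (n ∸ suc j)) j))
        (cong ℕ→ℚ (trans (sym (ℕP.+-suc (n ∸ suc j) j)) (ℕP.m∸n+n≡m j<n)))
      δb≈0 : δ * b ≈[ 1 ] 0ℚ
      δb≈0 = begin
        δ * b                                         ≡⟨ lemma P t (ℕ→ℚ j) δ b ⟩
        P * (t * b) - (y - (δ + ℕ→ℚ j)) * b           ≡⟨ cong (λ ν → P * (t * b) - (y - ν) * b) δ+j≡n ⟩
        P * (t * b) - (y - ℕ→ℚ n) * b                 ≡⟨ cong (λ z → P * (t * b) - z) ([x-k]*binom² n y) ⟩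
        P * (t * b) - y * ∏ n y                       ≈⟨ ≈-- (P*≈[1]0 (ℤₚ-* zt zb)) (≈-trans (≈-weaken IH) (P*≈[1]0 zt)) ⟩
        0ℚ - 0ℚ                                       ∎
        where open SetoidReasoning (≈-setoid 1)
      b≈0 : b ≈[ 1 ] 0ℚ
      b≈0 = ≈0-cancelˡ (invℕ (suc (n ∸ suc j))) (ℤₚ-1/ (ℕP.<-≤-trans (s≤s (ℕP.m∸n≤m m j)) n≤N))
        (trans (ℚP.*-comm (invℕ (suc (n ∸ suc j))) δ) (invℕ-inverseʳ (n ∸ suc j))) δb≈0
      open SetoidReasoning (≈-setoid 2)

    -- Dividing the previous congruence by j instead of pt + j leaves the error p t T, with T the
    -- product itself. This is harmless modulo p² once T ≡ 0 modulo p is known.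
    ∏[Pt+j]≈Pt/j : ∀ j → j < n → ∏ n (P * t + ℕ→ℚ (suc j)) ≈[ 2 ] P * t * invℕ (suc j)
    ∏[Pt+j]≈Pt/j j j<n = begin
      T                        ≡⟨ unit T ⟨
      1ℚ * T                   ≡⟨ cong (_* T) iκ≡1 ⟨
      i * κ * T                ≡⟨ lemma₁ i κ T P t ⟩
      i * ((P * t + κ) * T - P * (t * T)) ≈⟨ ≈-*ˡ zi (≈-- ([Pt+j]*∏≈Pt (suc j) j<n) (P*≈0 tT≈0)) ⟩
      i * (P * t - 0ℚ)         ≡⟨ lemma₂ i (P * t) ⟩
      P * t * i                ∎
      where
      T κ i : ℚ
      T = ∏ n (P * t + ℕ→ℚ (suc j))
      κ = ℕ→ℚ (suc j)
      i = invℕ (suc j)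
      zi : ℤₚ i
      zi = ℤₚ-1/ (ℕP.<-≤-trans j<n n≤N)
      zT : ℤₚ T
      zT = ℤₚ-∏ n n≤N (ℤₚ-Pt+ (suc j))
      unit : ∀ y → 1ℚ * y ≡ y
      unit = ℚP.*-identityˡ
      iκ≡1 : i * κ ≡ 1ℚ
      iκ≡1 = trans (ℚP.*-comm i κ) (invℕ-inverseʳ j)
      lemma₀ : ∀ κ T q t → κ * T ≡ (q * t + κ) * T - q * (t * T)
      lemma₀ = solve-∀ ℚ-ring
      lemma₁ : ∀ i κ T q t → i * κ * T ≡ i * ((q * t + κ) * T - q * (t * T))
      lemma₁ = solve-∀ ℚ-ring
      lemma₂ : ∀ i y → i * (y - 0ℚ) ≡ y * i
      lemma₂ = solve-∀ ℚ-ring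
      -- The same division, carried out modulo p only, where the error is trivially zero.
      T≈0 : T ≈[ 1 ] 0ℚ
      T≈0 = ≈0-cancelˡ i zi iκ≡1 (≈-trans (≈-reflexive (lemma₀ κ T P t))
        (≈-- (≈-trans (≈-weaken ([Pt+j]*∏≈Pt (suc j) j<n)) (P*≈[1]0 zt)) (P*≈[1]0 (ℤₚ-* zt zT))))
      tT≈0 : t * T ≈[ 1 ] 0ℚ
      tT≈0 = ≈-trans (≈-*ˡ zt T≈0) (≈-reflexive (ℚP.*-zeroʳ t))
      open SetoidReasoning (≈-setoid 2)

    binomSum[Pt+r] : ∀ r → r ≤ n → binomSum n (P * t + ℕ→ℚ r) ≈[ 2 ] binomSum n (P * t) + 2ℚ * (P * t * H r)
    binomSum[Pt+r] zero    _   = ≈-reflexive (trans (cong (binomSum n) (ℚP.+-identityʳ (P * t))) (lemma (binomSum n (P * t)) (P * t)))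
      where
      lemma : ∀ s y → s ≡ s + 2ℚ * (y * 0ℚ)
      lemma = solve-∀ ℚ-ring
    binomSum[Pt+r] (suc r) r<n = begin
      binomSum n (P * t + ℕ→ℚ (suc r))              ≡⟨ cong (binomSum n) (Pt+suc r) ⟩
      binomSum n (y + 1ℚ)                           ≡⟨ binomSum-difference n y ⟩
      binomSum n y + 2ℚ * ∏ n (y + 1ℚ)              ≡⟨ cong (λ z → binomSum n y + 2ℚ * ∏ n z) (Pt+suc r) ⟨
      binomSum n y + 2ℚ * ∏ n (P * t + ℕ→ℚ (suc r)) ≈⟨ ≈-+ (binomSum[Pt+r] r (ℕP.<⇒≤ r<n)) (≈-*ˡ (ℤₚ-ℕ 2) (∏[Pt+j]≈Pt/j r r<n)) ⟩
      binomSum n (P * t) + 2ℚ * (P * t * H r) + 2ℚ * (P * t * invℕ (suc r))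
        ≡⟨ lemma (binomSum n (P * t)) (P * t) (H r) (invℕ (suc r)) ⟩
      binomSum n (P * t) + 2ℚ * (P * t * H (suc r)) ∎
      where
      open SetoidReasoning (≈-setoid 2)
      y : ℚ
      y = P * t + ℕ→ℚ r
      lemma : ∀ s x h i → s + 2ℚ * (x * h) + 2ℚ * (x * i) ≡ s + 2ℚ * (x * (h + i))
      lemma = solve-∀ ℚ-ring

    -- Only `∏` is reduced, which is legitimate since p times the weight is integral. The factor pt
    -- + (k+1) then splits the result: the t² part is integral apart from its p, while the part
    -- linear in t keeps the possible 1/p and is summed exactly.
    binom²[Pt]/odd : ∀ k → k < n → binom² (suc k) (P * t) * invℕ (2 ℕ.* suc k ℕ.+ 1) ≈[ 2 ]
      - (P * (t * t) * (γ k * (invℕ (suc k) * invℕ (suc k))) + P * t * (invℕ (suc k) * invℕ (2 ℕ.* suc k ℕ.+ 1)))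
    binom²[Pt]/odd k k<n = begin
      binom² (suc k) (P * t) * g           ≡⟨ cong (_* g) (binom²-∏ k (P * t)) ⟩
      - (P * t * (P * t + κ) * ∏ k (P * t) * (i * i)) * g ≡⟨ lemma₁ P t κ (∏ k (P * t)) (i * i) g ⟩
      - (t * γ k * (P * t + κ) * (i * i)) * ∏ k (P * t)   ≈⟨ ≈-*ˡ zcoeff (∏[Pt]≈1 k (ℕP.<⇒≤ k<N)) ⟩
      - (t * γ k * (P * t + κ) * (i * i)) * 1ℚ            ≡⟨ lemma₂ P t κ i g ⟩
      - (P * (t * t) * (γ k * (i * i)) + P * t * (κ * i * i * g)) ≡⟨ cong (λ e → - (P * (t * t) * (γ k * (i * i)) + P * t * (e * i * g))) (invℕ-inverseʳ′ k) ⟩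
      - (P * (t * t) * (γ k * (i * i)) + P * t * (1ℚ * i * g))    ≡⟨ cong (λ e → - (P * (t * t) * (γ k * (i * i)) + P * t * (e * g))) (ℚP.*-identityˡ i) ⟩
      - (P * (t * t) * (γ k * (i * i)) + P * t * (i * g)) ∎
      where
      open SetoidReasoning (≈-setoid 2)
      κ i g : ℚ
      κ = ℕ→ℚ k + 1ℚ
      i = invℕ (suc k)
      g = invℕ (2 ℕ.* suc k ℕ.+ 1)
      k<N : k < N
      k<N = ℕP.<-≤-trans k<n n≤N
      zcoeff : ℤₚ (- (t * γ k * (P * t + κ) * (i * i)))
      zcoeff = ℤₚ-neg (ℤₚ-* (ℤₚ-* (ℤₚ-* zt (ℤₚ-γ k<n)) (ℤₚ-+ (ℤₚ-* (ℤₚ-ℕ p) zt) (ℤₚ-+ (ℤₚ-ℕ k) ℤₚ-1))) (ℤₚ-* (ℤₚ-1/ k<N) (ℤₚ-1/ k<N)))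
      lemma₁ : ∀ q t κ T j g → - (q * t * (q * t + κ) * T * j) * g ≡ - (t * (q * g) * (q * t + κ) * j) * T
      lemma₁ = solve-∀ ℚ-ring
      lemma₂ : ∀ q t κ i g → - (t * (q * g) * (q * t + κ) * (i * i)) * 1ℚ ≡ - (q * (t * t) * (q * g * (i * i)) + q * t * (κ * i * i * g))
      lemma₂ = solve-∀ ℚ-ring

    ∑binom²[Pt]/odd : ∑ n (λ k → binom² (suc k) (P * t) * invℕ (2 ℕ.* suc k ℕ.+ 1)) ≈[ 2 ]
      2ℚ * (t - P * t * (1ℚ + H n) - P * (t * t * 2ℚ))
    ∑binom²[Pt]/odd = begin
      ∑ n (λ k → binom² (suc k) (P * t) * invℕ (2 ℕ.* suc k ℕ.+ 1)) ≈⟨ ≈-∑ n binom²[Pt]/odd ⟩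
      ∑ n (λ k → - (P * (t * t) * f k + P * t * g k))   ≡⟨ ∑-neg n (λ k → P * (t * t) * f k + P * t * g k) ⟩
      - ∑ n (λ k → P * (t * t) * f k + P * t * g k)     ≡⟨ cong -_ (trans (∑-+ n (λ k → P * (t * t) * f k) (λ k → P * t * g k))
                                                            (cong₂ _+_ (∑-*ˡ n (P * (t * t)) f) (∑-*ˡ n (P * t) g))) ⟩
      - (P * (t * t) * ∑ n f + P * t * ∑ n g)           ≡⟨ cong (λ s → - (P * (t * t) * ∑ n f + P * t * s)) (∑-invℕ*invℕ-odd n) ⟩
      - (P * (t * t) * ∑ n f + P * t * (2ℚ * (H n - (H N + invℕ p) + 1ℚ)))
        -- H_p was unfolded to H_{p-1} + 1/p: the 1/p meets P and leaves t, and H_{p-1} will vanish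
        -- modulo p.
        ≡⟨ lemma₁ P t (∑ n f) (H n) (H N) (invℕ p) ⟩
      2ℚ * (t * (P * invℕ p) - P * t * (1ℚ + H n)) + P * (2ℚ * (t * H N)) - P * (t * t * ∑ n f)
        ≈⟨ ≈-- (≈-+ (≈-reflexive (cong (λ e → 2ℚ * (t * e - P * t * (1ℚ + H n))) (invℕ-inverseʳ N)))
             (≈-P* (≈-*ˡ (ℤₚ-ℕ 2) (≈-*ˡ zt H[N]≈0)))) (≈-P* (≈-*ˡ (ℤₚ-* zt zt) ∑γ/k²≈4)) ⟩
      2ℚ * (t * 1ℚ - P * t * (1ℚ + H n)) + P * (2ℚ * (t * 0ℚ)) - P * (t * t * 4ℚ)
        ≡⟨ lemma₂ P t (H n) ⟩
      2ℚ * (t - P * t * (1ℚ + H n) - P * (t * t * 2ℚ)) ∎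
      where
      open SetoidReasoning (≈-setoid 2)
      f g : ℕ → ℚ
      f k = γ k * (invℕ (suc k) * invℕ (suc k))
      g k = invℕ (suc k) * invℕ (2 ℕ.* suc k ℕ.+ 1)
      lemma₁ : ∀ q t f h k i → - (q * (t * t) * f + q * t * (2ℚ * (h - (k + i) + 1ℚ))) ≡
        2ℚ * (t * (q * i) - q * t * (1ℚ + h)) + q * (2ℚ * (t * k)) - q * (t * t * f)
      lemma₁ = solve-∀ ℚ-ring
      lemma₂ : ∀ q t h → 2ℚ * (t * 1ℚ - q * t * (1ℚ + h)) + q * (2ℚ * (t * 0ℚ)) - q * (t * t * 4ℚ) ≡
        2ℚ * (t - q * t * (1ℚ + h) - q * (t * t * 2ℚ))
      lemma₂ = solve-∀ ℚ-ring

    -- The prefactor 1 + 2pt contributes 2pt and 4pt², cancelling -2pt and -4pt² from the inner sum;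
    -- apart from the leading 1 + 2t only the harmonic term survives modulo p².
    binomSum[Pt] : binomSum n (P * t) ≈[ 2 ] 1ℚ + 2ℚ * t - 2ℚ * (P * t * H n)
    binomSum[Pt] = begin
      binomSum n (P * t)     ≡⟨ binomSum-factor n (P * t) ⟩
      (2ℚ * (P * t) + 1ℚ) * (1ℚ + ∑ n (λ k → binom² (suc k) (P * t) * invℕ (2 ℕ.* suc k ℕ.+ 1)))
        ≈⟨ ≈-*ˡ (ℤₚ-+ (ℤₚ-* (ℤₚ-ℕ 2) (ℤₚ-* (ℤₚ-ℕ p) zt)) ℤₚ-1) (≈-+ (≈-refl {x = 1ℚ}) ∑binom²[Pt]/odd) ⟩
      (2ℚ * (P * t) + 1ℚ) * (1ℚ + 2ℚ * (t - P * t * (1ℚ + H n) - P * (t * t * 2ℚ)))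
        ≡⟨ lemma P t (H n) ⟩
      c - P * (P * (2ℚ * 2ℚ * (t * (t * (1ℚ + H n) + t * t * 2ℚ))))
        ≈⟨ ≈-- (≈-refl {x = c}) (P*P*≈0 (ℤₚ-* (ℤₚ-* (ℤₚ-ℕ 2) (ℤₚ-ℕ 2)) (ℤₚ-* zt (ℤₚ-+ (ℤₚ-* zt (ℤₚ-+ ℤₚ-1 (ℤₚ-H n n≤N))) (ℤₚ-* (ℤₚ-* zt zt) (ℤₚ-ℕ 2)))))) ⟩
      c - 0ℚ                 ≡⟨ ℚP.+-identityʳ c ⟩
      c ∎
      where
      open SetoidReasoning (≈-setoid 2)
      c : ℚ
      c = 1ℚ + 2ℚ * t - 2ℚ * (P * t * H n)
      lemma : ∀ q t h → (2ℚ * (q * t) + 1ℚ) * (1ℚ + 2ℚ * (t - q * t * (1ℚ + h) - q * (t * t * 2ℚ))) ≡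
        1ℚ + 2ℚ * t - 2ℚ * (q * t * h) - q * (q * (2ℚ * 2ℚ * (t * (t * (1ℚ + h) + t * t * 2ℚ))))
      lemma = solve-∀ ℚ-ring

    binomSum≈ : ∀ r → r ≤ n → binomSum n (P * t + ℕ→ℚ r) ≈[ 2 ]
      1ℚ + 2ℚ * t - 2ℚ * (P * t * H n) + 2ℚ * (P * t * H r)
    binomSum≈ r r≤n = ≈-trans (binomSum[Pt+r] r r≤n) (≈-+ binomSum[Pt] ≈-refl)

  -- The two cases of the congruence

  add-harmonic≈ : ∀ c {u h D} → ℤₚ u → h ≈[ 1 ] - D →
    c - 2ℚ * (P * u * H n) + 2ℚ * (P * u * h) ≈[ 2 ]
    c + 4ℚ * P * u * fermatQuot2 p - 2ℚ * P * u * D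
  add-harmonic≈ c {u} {h} {D} zu h≈-D = begin
    c - 2ℚ * (P * u * H n) + 2ℚ * (P * u * h)       ≡⟨ lemma₁ c P u (H n) h ⟩
    c + P * (2ℚ * u * - H n) + P * (2ℚ * u * h)     ≈⟨ ≈-+ (≈-+ (≈-refl {x = c}) (≈-P* (≈-*ˡ z2u (≈-sym 2*fermatQuot2≈)))) (≈-P* (≈-*ˡ z2u h≈-D)) ⟩
    c + P * (2ℚ * u * (2ℚ * fermatQuot2 p)) + P * (2ℚ * u * - D) ≡⟨ lemma₂ c P u (fermatQuot2 p) D ⟩
    c + 4ℚ * P * u * fermatQuot2 p - 2ℚ * P * u * D ∎
    where
    open SetoidReasoning (≈-setoid 2)
    z2u : ℤₚ (2ℚ * u)
    z2u = ℤₚ-* (ℤₚ-ℕ 2) zu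
    lemma₁ : ∀ c q u k h → c - 2ℚ * (q * u * k) + 2ℚ * (q * u * h) ≡
      c + q * (2ℚ * u * - k) + q * (2ℚ * u * h)
    lemma₁ = solve-∀ ℚ-ring
    lemma₂ : ∀ c q u f D → c + q * (2ℚ * u * (2ℚ * f)) + q * (2ℚ * u * - D) ≡
      c + 4ℚ * q * u * f - 2ℚ * q * u * D
    lemma₂ = solve-∀ ℚ-ring

  module _ (t : ℚ) (zt : ℤₚ t) (r : ℕ) (r≤N : r ≤ N) where

    a : ℚ
    a = P * t + ℕ→ℚ r

    H≈-Δ : H r ≈[ 1 ] - Δ (- a)
    H≈-Δ = begin
      H r               ≡⟨ double-neg (H r) ⟩
      - - H r           ≈⟨ ≈-neg (≈-sym (Δ≈-H r r≤N)) ⟩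
      - Δ (- ℕ→ℚ r)     ≈⟨ ≈-neg (Δ-cong (ℤₚ-neg (ℤₚ-ℕ r)) (ℤₚ-neg (ℤₚ-Pt+ t zt r)) (≈-neg r≈a)) ⟩
      - Δ (- a)         ∎
      where
      open SetoidReasoning (≈-setoid 1)
      double-neg : ∀ x → x ≡ - - x
      double-neg = solve-∀ ℚ-ring
      r≈a : ℕ→ℚ r ≈[ 1 ] a
      r≈a = ≈-sym (≈-trans (≈-+ (P*≈[1]0 zt) (≈-refl {x = ℕ→ℚ r})) (≈-reflexive (ℚP.+-identityˡ (ℕ→ℚ r))))

    binomSum-≤ : r ≤ n → binomSum n a ≈[ 2 ]
      1ℚ + 2ℚ * t + 4ℚ * P * t * fermatQuot2 p - 2ℚ * P * t * Δ (- a)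
    binomSum-≤ r≤n = ≈-trans (binomSum≈ t zt r r≤n) (add-harmonic≈ (1ℚ + 2ℚ * t) zt H≈-Δ)

    -- The reflection a ↦ −1 − a negates the sum and sends (t, r) to (−(t + 1), p − 1 − r).
    binomSum-> : n < r → binomSum n a ≈[ 2 ]
      1ℚ + 2ℚ * t + 4ℚ * P * (t + 1ℚ) * fermatQuot2 p - 2ℚ * P * (t + 1ℚ) * Δ (- a)
    binomSum-> n<r = begin
      binomSum n a               ≡⟨ cong (binomSum n) (reflect-involutive a) ⟨
      binomSum n (- 1ℚ - a′)     ≡⟨ binomSum-reflect n a′ ⟩
      - binomSum n a′            ≡⟨ cong (λ y → - binomSum n y) a′≡ ⟩
      - binomSum n (P * t′ + ℕ→ℚ r′) ≈⟨ ≈-neg (binomSum≈ t′ zt′ r′ r′≤n) ⟩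
      - (1ℚ + 2ℚ * t′ - 2ℚ * (P * t′ * H n) + 2ℚ * (P * t′ * H r′)) ≡⟨ lemma P t (H n) (H r′) ⟩
      1ℚ + 2ℚ * t - 2ℚ * (P * (t + 1ℚ) * H n) + 2ℚ * (P * (t + 1ℚ) * H r′)
        ≈⟨ add-harmonic≈ (1ℚ + 2ℚ * t) (ℤₚ-+ zt ℤₚ-1) (≈-trans (H-reflect r r′ r+r′≡N) H≈-Δ) ⟩
      1ℚ + 2ℚ * t + 4ℚ * P * (t + 1ℚ) * fermatQuot2 p - 2ℚ * P * (t + 1ℚ) * Δ (- a) ∎
      where
      open SetoidReasoning (≈-setoid 2)
      a′ t′ : ℚ
      a′ = - 1ℚ - a
      t′ = - (t + 1ℚ)
      r′ : ℕ
      r′ = N ∸ r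
      zt′ : ℤₚ t′
      zt′ = ℤₚ-neg (ℤₚ-+ zt ℤₚ-1)
      r+r′≡N : r ℕ.+ r′ ≡ N
      r+r′≡N = ℕP.m+[n∸m]≡n r≤N
      r′≤n : r′ ≤ n
      r′≤n = ℕP.m≤n+o⇒m∸n≤o N r (ℕP.+-mono-≤ (ℕP.<⇒≤ n<r) (ℕP.≤-reflexive (ℕP.+-identityʳ n)))
      P≡ : P ≡ ℕ→ℚ r + ℕ→ℚ r′ + 1ℚ
      P≡ = trans (ℕ→ℚ-suc N) (cong (_+ 1ℚ) (trans (cong ℕ→ℚ (sym r+r′≡N)) (ℕ→ℚ-+ r r′)))
      reflect : ∀ ρ ρ′ t → - 1ℚ - ((ρ + ρ′ + 1ℚ) * t + ρ) ≡ (ρ + ρ′ + 1ℚ) * - (t + 1ℚ) + ρ′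
      reflect = solve-∀ ℚ-ring
      a′≡ : a′ ≡ P * t′ + ℕ→ℚ r′
      a′≡ = subst (λ q → - 1ℚ - (q * t + ℕ→ℚ r) ≡ q * t′ + ℕ→ℚ r′) (sym P≡) (reflect (ℕ→ℚ r) (ℕ→ℚ r′) t)
      lemma : ∀ q t k h → - (1ℚ + 2ℚ * - (t + 1ℚ) - 2ℚ * (q * - (t + 1ℚ) * k) + 2ℚ * (q * - (t + 1ℚ) * h)) ≡
        1ℚ + 2ℚ * t - 2ℚ * (q * (t + 1ℚ) * k) + 2ℚ * (q * (t + 1ℚ) * h)
      lemma = solve-∀ ℚ-ring

-- Passage to the stated form

prime>3⇒odd : ∀ {p} → Prime p → 3 < p → ∃ λ m → p ≡ suc (2 ℕ.* suc m)
prime>3⇒odd {p} p-prime 3<p with p ℕ.% 2 | p / 2 | ℕD.m≡m%n+[m/n]*n p 2 | ℕD.m%n<n p 2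
... | 0 | q | p≡ | _ with prime⇒irreducible p-prime (divides q p≡)
...   | inj₁ ()
...   | inj₂ refl = contradiction 3<p λ { (s≤s (s≤s ())) }
prime>3⇒odd _ 3<p | 1 | zero  | refl | _ = contradiction 3<p λ { (s≤s ()) }
prime>3⇒odd _ _   | 1 | suc m | p≡   | _ = m , trans p≡ (cong suc (ℕP.*-comm (suc m) 2))
prime>3⇒odd _ _   | suc (suc _) | _ | _ | s≤s (s≤s ())

-- The shape of p is an equation rather than an index, so that matching on `refl` makes p - 1 and (p
-- - 1)/2 computable while p stays a variable for the caller.
binomSum-mod-p² : ∀ p m → p ≡ suc (2 ℕ.* suc m) → Prime p → ∀ a r → r < p → a ≡ ℕ→ℚ r [mod p ^ 1 ] →
  let t = (a - ℕ→ℚ r) * invℕ p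
      h = (p ∸ 1) / 2
      D = bernoulliPoly (p ∸ 1) (- a) - bernoulli (p ∸ 1)
      P = ℕ→ℚ p
  in (r ≤ h → sumTo (suc h) (binomSummand a) ≡ 1ℚ + 2ℚ * t + 4ℚ * P * t * fermatQuot2 p - 2ℚ * P * t * D [mod p ^ 2 ])
   × (r > h → sumTo (suc h) (binomSummand a) ≡ 1ℚ + 2ℚ * t + 4ℚ * P * (t + 1ℚ) * fermatQuot2 p - 2ℚ * P * (t + 1ℚ) * D [mod p ^ 2 ])
binomSum-mod-p² .(suc (2 ℕ.* suc m)) m refl p-prime a r r<p (z , zz , a-r≡Pz) =
  (λ r≤h → ≈⇒mod (subst₂ (λ s b → s ≈[ 2 ] 1ℚ + 2ℚ * t + 4ℚ * P * t * fermatQuot2 p - 2ℚ * P * t * Δ (- b))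
    S≡ Pt+r≡a (binomSum-≤ t zt r r≤N (subst (r ≤_) half≡n r≤h))))
  , (λ r>h → ≈⇒mod (subst₂ (λ s b → s ≈[ 2 ] 1ℚ + 2ℚ * t + 4ℚ * P * (t + 1ℚ) * fermatQuot2 p - 2ℚ * P * (t + 1ℚ) * Δ (- b))
    S≡ Pt+r≡a (binomSum-> t zt r r≤N (subst (_< r) half≡n r>h))))
  where
  open OddPrime m p-prime hiding (a)
  t : ℚ
  t = (a - ℕ→ℚ r) * invℕ p
  r≤N : r ≤ N
  r≤N = ℕP.≤-pred r<p
  half≡n : N / 2 ≡ n
  half≡n = trans (cong (_/ 2) (ℕP.*-comm 2 n)) (ℕD.m*n/n≡m n 2)
  cancel : ∀ q z i → q * 1ℚ * z * i ≡ z * (q * i)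
  cancel = solve-∀ ℚ-ring
  -- The quotient t is the witness of the congruence between a and r, and so inherits its
  -- integrality.
  t≡z : t ≡ z
  t≡z = trans (cong (_* invℕ p) a-r≡Pz) (trans (cancel P z (invℕ p)) (trans (cong (z *_) (invℕ-inverseʳ N)) (ℚP.*-identityʳ z)))
  zt : ℤₚ t
  zt = subst ℤₚ (sym t≡z) (InZp⇒ℤₚ z zz)
  restore : ∀ a ρ → a - ρ + ρ ≡ a
  restore = solve-∀ ℚ-ring
  Pt+r≡a : P * t + ℕ→ℚ r ≡ a
  Pt+r≡a = trans (cong (_+ ℕ→ℚ r) (trans (cong (P *_) t≡z) (trans (cong (_* z) (sym (ℚP.*-identityʳ P))) (sym a-r≡Pz)))) (restore a (ℕ→ℚ r))
  S≡ : binomSum n (P * t + ℕ→ℚ r) ≡ sumTo (suc (N / 2)) (binomSummand a)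
  S≡ = trans (cong₂ binomSum (sym half≡n) Pt+r≡a) (sym (sumTo≡∑ (suc (N / 2)) (binomSummand a)))

theorem4p1 : (p : ℕ) → Prime p → 3 < p →
    (a : ℚ) → InZp p a → ¬ (a ≡ 0ℚ [mod p ^ 1 ]) →
    (r : ℕ) → r < p → a ≡ ℕ→ℚ r [mod p ^ 1 ] →
    let t = (a - ℕ→ℚ r) * invℕ p
        S = sumTo (suc ((p ∸ 1) / 2)) (λ k → binomℚ a k * binomℚ (- 1ℚ - a) k * ((ℕ→ℚ 2 * a + 1ℚ) * invℕ (2 ℕ.* k ℕ.+ 1)))
        D = bernoulliPoly (p ∸ 1) (- a) - bernoulli (p ∸ 1)
        P = ℕ→ℚ p
    in (r ≤ (p ∸ 1) / 2 → S ≡ 1ℚ + ℕ→ℚ 2 * t + ℕ→ℚ 4 * P * t * fermatQuot2 p - ℕ→ℚ 2 * P * t * D [mod p ^ 2 ])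
     × (r > (p ∸ 1) / 2 → S ≡ 1ℚ + ℕ→ℚ 2 * t + ℕ→ℚ 4 * P * (t + 1ℚ) * fermatQuot2 p - ℕ→ℚ 2 * P * (t + 1ℚ) * D [mod p ^ 2 ])
theorem4p1 p p-prime 3<p a _ _ r r<p a≡r =
  binomSum-mod-p² p (proj₁ odd) (proj₂ odd) p-prime a r r<p a≡r
  where odd = prime>3⇒odd p-prime 3<p
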